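{- For all integers $n\ge 0$ and $i \geq 0$ and all real $x$, the $i$-th derivatives of the Cauchy polynomials can be expressed by $$\frac{d^i c_n(x)}{d x^i} = (-1)^i i! \sum_{m=i}^n \binom{n}{m} \binom{m}{i}\frac{B_{m-i}^{(n+1)}(1-x)}{n+1-m}$$ and $$\frac{d^i \widehat{c}_n(x)}{d x^i} = i! \sum_{m=i}^n (-1)^{n-m} \binom{n}{m} \binom{m}{i}\frac{B_{m-i}^{(n+1)}(x+1)}{n+1-m}.$$
   Context: For real $z$ and integer $n\ge 0$, $\binom{z}{n} = \frac{z(z-1)\cdots(z-n+1)}{n!}$. The Cauchy polynomials of the first and second kind are $c_n(x) = n! \int_{0}^{1} \binom{t - x}{n}\, dt$ and $\widehat{c}_n(x) = n! \int_{0}^{1} \binom{x - t}{n}\, dt$, $n \ge 0$. The generalized (higher-order) Bernoulli polynomials $B_n^{(\alpha)}(x)$ are defined by $\left( \frac{t}{e^t -1}\right)^{\alpha} e^{xt} = \sum_{n=0}^{\infty} B_n^{(\alpha)}(x) \frac{t^n}{n!}$, $|t|<2\pi$. Empty sums (when $i>n$) are $0$. -}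

module Defs where

open import Level using (_⊔_) renaming (suc to lsuc)
open import Algebra.Apartness.Bundles using (HeytingCommutativeRing; HeytingField)
open import Algebra.Bundles using (CommutativeRing; Semiring)
import Algebra.Definitions.RawSemiring as RawSemiringDefinitions
open import Data.Fin.Base as Fin using (Fin; zero; suc; toℕ; inject₁)
open import Data.Nat.Base as ℕ using (ℕ; zero; suc; _∸_; _!; NonZero)
open import Data.Nat.Properties using (_!≢0)
open import Data.Product.Base as Prod using (∃-syntax; _,_; proj₁; proj₂)
open import Data.Sum.Base using (_⊎_; inj₁; inj₂)
open import Data.Vec.Functional using (Vector; []; _∷_)
open import Relation.Binary.Core using (Rel)
open import Relation.Binary.PropositionalEquality as ≡ using (_≡_)
open import Relation.Binary.Structures using (IsStrictPartialOrder)
open import Relation.Nullary.Negation using (¬_)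

-- The real numbers, up to isomorphism: a Cauchy-complete Archimedean ordered
-- field.  The axioms are stated so that they hold constructively (for
-- instance for Bishop's reals): apartness is `<` or `>`, and only numbers
-- apart from 0 are invertible.

record RealNumbers c ℓ₁ ℓ₂ ℓ₃ : Set (lsuc (c ⊔ ℓ₁ ⊔ ℓ₂ ⊔ ℓ₃)) where
  infix 4 _<_ _≤_ ∣_∣<_

  field
    heytingField : HeytingField c ℓ₁ ℓ₂

  open HeytingField heytingField public
  open HeytingCommutativeRing heytingCommutativeRing public
    using (commutativeRing)
  open CommutativeRing commutativeRing public
    using (ring; semiring)
  open Semiring semiring public using (rawSemiring)
  open RawSemiringDefinitions rawSemiring public
    using (sum; product; _^_) renaming (_×_ to _·_)

  fromℕ : ℕ → Carrier
  fromℕ n = n · 1#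

  field
    _<_                    : Rel Carrier ℓ₃
    <-isStrictPartialOrder : IsStrictPartialOrder _≈_ _<_
    #⇒<⊎>                  : ∀ {x y} → x # y → x < y ⊎ y < x
    <⇒#                    : ∀ {x y} → x < y → x # y
    +-monoˡ-<              : ∀ z {x y} → x < y → x + z < y + z
    *-pos                  : ∀ {x y} → 0# < x → 0# < y → 0# < x * y
    archimedean            : ∀ x → ∃[ n ] x < fromℕ n

  _≤_ : Rel Carrier ℓ₃
  x ≤ y = ¬ (y < x)

  ∣_∣<_ : Rel Carrier ℓ₃
  ∣ x ∣< ε = (- ε < x) Prod.× (x < ε)

  IsCauchy : (ℕ → Carrier) → Set (c ⊔ ℓ₃)
  IsCauchy s = ∀ ε → 0# < ε →
    ∃[ N ] (∀ m n → N ℕ.≤ m → N ℕ.≤ n → ∣ s m - s n ∣< ε)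

  ConvergesTo : (ℕ → Carrier) → Carrier → Set (c ⊔ ℓ₃)
  ConvergesTo s l = ∀ ε → 0# < ε →
    ∃[ N ] (∀ n → N ℕ.≤ n → ∣ s n - l ∣< ε)

  field
    complete : ∀ s → IsCauchy s → ∃[ l ] ConvergesTo s l

module Analysis {c ℓ₁ ℓ₂ ℓ₃} (R : RealNumbers c ℓ₁ ℓ₂ ℓ₃) where

  open RealNumbers R hiding (zero)
  open IsStrictPartialOrder <-isStrictPartialOrder using ()
    renaming (trans to <-trans; <-respˡ-≈ to <-respˡ; <-respʳ-≈ to <-respʳ)
  open import Algebra.Apartness.Properties.HeytingCommutativeRing
    heytingCommutativeRing using (1#0; x-0≈x)
  open import Algebra.Properties.Ring ring using (-‿distribˡ-*; -‿involutive)
  open import Algebra.Properties.Semiring.Sum semiring using (sum-cong-≋)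

  inverse : ∀ x → x # 0# → Carrier
  inverse x x#0 = proj₁ (#⇒invertible x#0)

  0<1 : 0# < 1#
  0<1 with #⇒<⊎> 1#0
  ... | inj₂ 0<1 = 0<1
  ... | inj₁ 1<0 = <-respʳ [-1]²≈1 (*-pos 0<-1 0<-1)
    where
    0<-1 : 0# < - 1#
    0<-1 = <-respʳ (+-identityˡ _) (<-respˡ (-‿inverseʳ 1#) (+-monoˡ-< (- 1#) 1<0))

    [-1]²≈1 : (- 1#) * (- 1#) ≈ 1#
    [-1]²≈1 = trans (sym (-‿distribˡ-* _ _))
                    (trans (-‿cong (*-identityˡ _)) (-‿involutive 1#))

  0<fromℕ[1+n] : ∀ n → 0# < fromℕ (suc n)
  0<fromℕ[1+n] zero    = <-respʳ (sym (+-identityʳ 1#)) 0<1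
  0<fromℕ[1+n] (suc n) = <-trans (0<fromℕ[1+n] n)
    (<-respˡ (+-identityˡ _) (+-monoˡ-< (fromℕ (suc n)) 0<1))

  fromℕ#0 : ∀ n .{{_ : NonZero n}} → fromℕ n # 0#
  fromℕ#0 (suc n) = #-sym (<⇒# (0<fromℕ[1+n] n))

  infixl 7 _/_ _/!_
  _/_ : Carrier → (n : ℕ) .{{_ : NonZero n}} → Carrier
  x / n = x * inverse (fromℕ n) (fromℕ#0 n)

  _/!_ : Carrier → ℕ → Carrier
  x /! n = _/_ x (n !) {{n !≢0}}

  -- The sum is empty when i > n.
  sumFromTo : ℕ → ℕ → (ℕ → Carrier) → Carrier
  sumFromTo i n f = sum {suc n ∸ i} λ k → f (i ℕ.+ toℕ k)

  infixl 5 sumFromTo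
  syntax sumFromTo i n (λ m → e) = ∑[ m from i to n ] e

  binomial : Carrier → ℕ → Carrier
  binomial z n = product {n} (λ k → z - fromℕ (toℕ k)) /! n

  HasDerivativeAt : (Carrier → Carrier) → Carrier → Carrier → Set (c ⊔ ℓ₂ ⊔ ℓ₃)
  HasDerivativeAt f d x = ∀ ε → 0# < ε → ∃[ δ ] (0# < δ) Prod.×
    (∀ h (h#0 : h # 0#) → ∣ h ∣< δ →
      ∣ (f (x + h) - f x) * inverse h h#0 - d ∣< ε)

  -- IsIteratedDerivative i f g: dⁱf/dxⁱ exists everywhere and equals g.
  data IsIteratedDerivative : ℕ → Rel (Carrier → Carrier) (c ⊔ ℓ₁ ⊔ ℓ₂ ⊔ ℓ₃) where
    base : ∀ {f g} → (∀ x → f x ≈ g x) → IsIteratedDerivative zero f g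
    step : ∀ {i f g g′} → IsIteratedDerivative i f g →
           (∀ x → HasDerivativeAt g (g′ x) x) → IsIteratedDerivative (suc i) f g′

  record TaggedPartition (a b : Carrier) : Set (c ⊔ ℓ₁ ⊔ ℓ₃) where
    field
      size      : ℕ
      point     : Fin (suc size) → Carrier
      tag       : Fin size → Carrier
      start     : point zero ≈ a
      end       : point (Fin.fromℕ size) ≈ b
      point≤tag : ∀ k → point (inject₁ k) ≤ tag k
      tag≤point : ∀ k → tag k ≤ point (suc k)

    width : Fin size → Carrier
    width k = point (suc k) - point (inject₁ k)

    riemannSum : (Carrier → Carrier) → Carrier
    riemannSum f = sum λ k → f (tag k) * width k

  open TaggedPartition

  IsIntegral : Carrier → Carrier → (Carrier → Carrier) → Carrier → Set (c ⊔ ℓ₁ ⊔ ℓ₃)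
  IsIntegral a b f I = ∀ ε → 0# < ε → ∃[ δ ] (0# < δ) Prod.×
    (∀ (P : TaggedPartition a b) → (∀ k → width P k < δ) →
      ∣ riemannSum P f - I ∣< ε)

  IsCauchyPolynomial₁ : (ℕ → Carrier → Carrier) → Set (c ⊔ ℓ₁ ⊔ ℓ₃)
  IsCauchyPolynomial₁ p = ∀ n x → ∃[ I ]
    IsIntegral 0# 1# (λ t → binomial (t - x) n) I Prod.× p n x ≈ fromℕ (n !) * I

  IsCauchyPolynomial₂ : (ℕ → Carrier → Carrier) → Set (c ⊔ ℓ₁ ⊔ ℓ₃)
  IsCauchyPolynomial₂ p = ∀ n x → ∃[ I ]
    IsIntegral 0# 1# (λ t → binomial (x - t) n) I Prod.× p n x ≈ fromℕ (n !) * I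

  -- Formal power series, given by their coefficients.
  Series : Set c
  Series = ℕ → Carrier

  infixl 7 _⊛_
  infixr 8 _^ˢ_

  oneˢ : Series
  oneˢ zero    = 1#
  oneˢ (suc _) = 0#

  _⊛_ : Series → Series → Series
  (f ⊛ g) n = ∑[ k from 0 to n ] (f k * g (n ∸ k))

  _^ˢ_ : Series → ℕ → Series
  f ^ˢ zero  = oneˢ
  f ^ˢ suc α = f ⊛ f ^ˢ α

  -- The first n coefficients, last one first, of the reciprocal of a series
  -- with constant coefficient 1.
  reciprocals : Series → ∀ n → Vector Carrier n
  reciprocals f zero          = []
  reciprocals f (suc zero)    = 1# ∷ []
  reciprocals f (suc (suc n)) =
    - sum (λ k → f (suc (toℕ k)) * reciprocals f (suc n) k) ∷ reciprocals f (suc n)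

  reciprocal : Series → Series
  reciprocal f n = reciprocals f (suc n) zero

  reciprocals≡reciprocal : ∀ f n k →
    reciprocals f n k ≡ reciprocal f (n ∸ suc (toℕ k))
  reciprocals≡reciprocal f (suc n)       zero    = ≡.refl
  reciprocals≡reciprocal f (suc (suc n)) (suc k) = reciprocals≡reciprocal f (suc n) k

  ⊛-reciprocal : ∀ f → f 0 ≈ 1# → ∀ n → (f ⊛ reciprocal f) n ≈ oneˢ n
  ⊛-reciprocal f f₀≈1 zero = trans (+-identityʳ _) (trans (*-identityʳ _) f₀≈1)
  ⊛-reciprocal f f₀≈1 (suc n) = trans
    (+-cong
      (trans (*-congʳ f₀≈1) (*-identityˡ _))
      (sum-cong-≋ λ k → *-congˡ {f (suc (toℕ k))} (reflexive (≡.sym (reciprocals≡reciprocal f (suc n) k)))))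
    (-‿inverseˡ _)

  -- e^{xt}
  expˢ : Carrier → Series
  expˢ x n = x ^ n /! n

  -- (e^t - 1)/t
  expm1/tˢ : Series
  expm1/tˢ n = 1# /! suc n

  expm1/tˢ-reciprocal : ∀ n → (expm1/tˢ ⊛ reciprocal expm1/tˢ) n ≈ oneˢ n
  expm1/tˢ-reciprocal = ⊛-reciprocal expm1/tˢ (trans
    (*-congʳ (sym (trans (x-0≈x _) (+-identityʳ 1#))))
    (proj₂ (proj₂ (#⇒invertible (fromℕ#0 1)))))

  -- bernoulli α n x is B_n^{(α)}(x), for natural orders α: n! times the
  -- coefficient of tⁿ in (t/(e^t - 1))^α e^{xt}.
  bernoulli : ℕ → ℕ → Carrier → Carrier
  bernoulli α n x = fromℕ (n !) * (reciprocal expm1/tˢ ^ˢ α ⊛ expˢ x) n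

-- Write B α y = (t/(e^t - 1))^α e^{yt} for the power series with coefficients
-- B_n^{(α)}(y)/n!, and [t^n] for its n-th coefficient.
--
-- Since θ = t d/dt is a derivation of the ring of power series, the coefficients
-- satisfy n [t^n] B (n+1) y = (y - n) [t^{n-1}] B n y, hence
-- [t^n] B (n+1) (1 + w) is the binomial coefficient of w over n.  As
-- d/dy B α y = t B α y and B (α+1) (y+1) - B (α+1) y = t B α y, the two
-- integrals collapse to c_n(x) = n! [t^n] B n (1 - x) and
-- ĉ_n(x) = n! [t^n] B n x, whose i-th derivatives are n! [t^{n-i}] of the same
-- series, up to the sign (-1)^i.  The sums over m are these coefficients
-- expanded along B n y = B (n+1) y · (e^t - 1)/t and
-- B n y = B (n+1) (y+1) · (1 - e^{-t})/t.
--
-- Both the derivatives and the integrals (limits of Riemann sums over uniform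
-- partitions) come from f(x+h) = f(x) + h f′(x) + h² q(x,h) with q bounded.

module Submission where

open import Algebra.Bundles using (CommutativeRing; RawRing)
open import Algebra.Structures using (IsCommutativeRing)
open import Data.Nat.Base as ℕ using (ℕ; zero; suc; _∸_; _!; NonZero)
open import Data.Nat.Combinatorics using (_C_; nCk≡n!/k![n-k]!; k![n∸k]!∣n!)
open import Data.Nat.DivMod using (m/n*n≡m)
import Data.Nat.Properties as ℕₚ
open import Level using (_⊔_)
open import Data.Empty using (⊥; ⊥-elim)
open import Data.Fin.Base as Fin using (Fin; toℕ; inject₁)
open import Data.Fin.Properties using (toℕ-inject₁; toℕ-fromℕ; toℕ<n; toℕ≤pred[n])
open import Data.Maybe.Base using (Maybe; just; nothing)
open import Data.Product.Base using (_×_; _,_; proj₁; proj₂; ∃-syntax)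
open import Data.Sum.Base using (_⊎_; inj₁; inj₂)
open import Relation.Binary.Structures using (IsStrictPartialOrder)
open import Relation.Nullary.Decidable using (yes; no)
import Relation.Binary.PropositionalEquality as ≡
open ≡ using (_≡_)
import Algebra.Solver.Ring as RingSolver
open import Algebra.Solver.Ring.AlmostCommutativeRing using (_-Raw-AlmostCommutative⟶_; fromCommutativeRing)
import Algebra.Properties.Semiring.Mult as Mult
import Algebra.Properties.Semiring.Mult.TCOptimised as MultTC
import Algebra.Properties.Semiring.Sum as Sum
import Algebra.Properties.Ring as RingProperties
import Relation.Binary.Reasoning.Setoid as SetoidReasoning
open import Defs

-- A ring solver with integer coefficients

-- A pair (a , b) stands for the integer a - b.  Sums and products are reduced
-- because the solver compares normal forms definitionally.
module IntegerSolver {c ℓ} (R : CommutativeRing c ℓ) where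
  open CommutativeRing R
  open Mult semiring using (×-homo-+; ×1-homo-*) renaming (_×_ to _·_)
  open MultTC semiring using (×ᵤ≈×) renaming (_×_ to _·′_)
  open RingProperties ring
  open SetoidReasoning setoid

  reduce : ℕ → ℕ → ℕ × ℕ
  reduce (suc a) (suc b) = reduce a b
  reduce a       b       = a , b

  integers : RawRing _ _
  integers = record
    { Carrier = ℕ × ℕ
    ; _≈_     = _≡_
    ; _+_     = λ (a , b) (a′ , b′) → reduce (a ℕ.+ a′) (b ℕ.+ b′)
    ; _*_     = λ (a , b) (a′ , b′) → reduce (a ℕ.* a′ ℕ.+ b ℕ.* b′) (a ℕ.* b′ ℕ.+ b ℕ.* a′)
    ; -_      = λ (a , b) → b , a
    ; 0#      = 0 , 0
    ; 1#      = 1 , 0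
    }
  private module ℤ = RawRing integers

  -- The separate case for `zero` and the optimised multiple make the pairs for 0 and 1 evaluate to
  -- `0#` and `1#` by computation, so that solved equations match goals written with these
  -- constants.
  ⟦_⟧ᶻ : ℤ.Carrier → Carrier
  ⟦ a , zero ⟧ᶻ        = a ·′ 1#
  ⟦ a , b@(suc _) ⟧ᶻ = a ·′ 1# - b ·′ 1#

  -- The same value without a case distinction, on which the homomorphism laws are proved.
  difference : ℤ.Carrier → Carrier
  difference (a , b) = a · 1# - b · 1#

  ⟦⟧≈difference : ∀ z → ⟦ z ⟧ᶻ ≈ difference z
  ⟦⟧≈difference (a , zero)  = begin
    a ·′ 1#     ≈⟨ ×ᵤ≈× a 1# ⟨
    a · 1#      ≈⟨ +-identityʳ _ ⟨
    a · 1# + 0# ≈⟨ +-congˡ -0#≈0# ⟨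
    a · 1# - 0# ∎
  ⟦⟧≈difference (a , suc b) = sym (+-cong (×ᵤ≈× a 1#) (-‿cong (×ᵤ≈× (suc b) 1#)))

  +-interchange : ∀ a b a′ b′ → (a + a′) + (b + b′) ≈ (a + b) + (a′ + b′)
  +-interchange a b a′ b′ = begin
    (a + a′) + (b + b′) ≈⟨ +-assoc a a′ _ ⟩
    a + (a′ + (b + b′)) ≈⟨ +-congˡ (+-assoc a′ b b′) ⟨
    a + ((a′ + b) + b′) ≈⟨ +-congˡ (+-congʳ (+-comm a′ b)) ⟩
    a + ((b + a′) + b′) ≈⟨ +-congˡ (+-assoc b a′ b′) ⟩
    a + (b + (a′ + b′)) ≈⟨ +-assoc a b _ ⟨
    (a + b) + (a′ + b′) ∎

  difference-cancel : ∀ u v w → (u + w) - (v + w) ≈ u - v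
  difference-cancel u v w = begin
    (u + w) - (v + w)         ≈⟨ +-congˡ (-‿+-comm v w) ⟨
    (u + w) + (- v + - w)     ≈⟨ +-interchange _ _ _ _ ⟩
    (u - v) + (w - w)         ≈⟨ +-congˡ (-‿inverseʳ w) ⟩
    (u - v) + 0#              ≈⟨ +-identityʳ _ ⟩
    u - v                     ∎

  difference-reduce : ∀ a b → difference (reduce a b) ≈ difference (a , b)
  difference-reduce zero    b       = refl
  difference-reduce (suc a) zero    = refl
  difference-reduce (suc a) (suc b) = begin
    difference (reduce a b)           ≈⟨ difference-reduce a b ⟩
    a · 1# - b · 1#                   ≈⟨ difference-cancel _ _ _ ⟨
    (a · 1# + 1#) - (b · 1# + 1#)     ≈⟨ +-cong (+-comm _ _) (-‿cong (+-comm _ _)) ⟩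
    (1# + a · 1#) - (1# + b · 1#)     ∎

  difference-+ : ∀ y z → difference (y ℤ.+ z) ≈ difference y + difference z
  difference-+ (a , b) (a′ , b′) = begin
    difference (reduce (a ℕ.+ a′) (b ℕ.+ b′))       ≈⟨ difference-reduce (a ℕ.+ a′) (b ℕ.+ b′) ⟩
    (a ℕ.+ a′) · 1# - (b ℕ.+ b′) · 1#               ≈⟨ +-cong (×-homo-+ 1# a a′) (-‿cong (×-homo-+ 1# b b′)) ⟩
    (a · 1# + a′ · 1#) - (b · 1# + b′ · 1#)         ≈⟨ +-congˡ (-‿+-comm _ _) ⟨
    (a · 1# + a′ · 1#) + (- (b · 1#) + - (b′ · 1#)) ≈⟨ +-interchange _ _ _ _ ⟩
    (a · 1# - b · 1#) + (a′ · 1# - b′ · 1#)         ∎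

  difference-neg : ∀ z → difference (ℤ.- z) ≈ - difference z
  difference-neg (a , b) = begin
    b · 1# - a · 1#       ≈⟨ +-comm _ _ ⟩
    - (a · 1#) + b · 1#   ≈⟨ +-congˡ (-‿involutive _) ⟨
    - (a · 1#) - - (b · 1#) ≈⟨ -‿+-comm _ _ ⟩
    - (a · 1# - b · 1#)   ∎

  difference-* : ∀ y z → difference (y ℤ.* z) ≈ difference y * difference z
  difference-* (a , b) (a′ , b′) = begin
    difference (reduce (a ℕ.* a′ ℕ.+ b ℕ.* b′) (a ℕ.* b′ ℕ.+ b ℕ.* a′))
      ≈⟨ difference-reduce (a ℕ.* a′ ℕ.+ b ℕ.* b′) (a ℕ.* b′ ℕ.+ b ℕ.* a′) ⟩
    (a ℕ.* a′ ℕ.+ b ℕ.* b′) · 1# - (a ℕ.* b′ ℕ.+ b ℕ.* a′) · 1#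
      ≈⟨ +-cong (homo a a′ b b′) (-‿cong (homo a b′ b a′)) ⟩
    (p * p′ + q * q′) - (p * q′ + q * p′)
      ≈⟨ +-congˡ (-‿+-comm _ _) ⟨
    (p * p′ + q * q′) + (- (p * q′) + - (q * p′))
      ≈⟨ +-interchange _ _ _ _ ⟩
    (p * p′ - p * q′) + (q * q′ - q * p′)
      ≈⟨ +-cong (sym (*-distribˡ-minus p p′ q′)) (trans (sym (*-distribˡ-minus q q′ p′)) (trans (*-congˡ (difference-neg (a′ , b′))) (trans (sym (-‿distribʳ-* _ _)) (-‿distribˡ-* _ _)))) ⟩
    p * (p′ - q′) + - q * (p′ - q′)
      ≈⟨ distribʳ _ _ _ ⟨
    (p - q) * (p′ - q′) ∎
    where
    p = a · 1#
    q = b · 1#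
    p′ = a′ · 1#
    q′ = b′ · 1#
    homo : ∀ k l m n → (k ℕ.* l ℕ.+ m ℕ.* n) · 1# ≈ (k · 1#) * (l · 1#) + (m · 1#) * (n · 1#)
    homo k l m n = trans (×-homo-+ 1# (k ℕ.* l) (m ℕ.* n)) (+-cong (×1-homo-* k l) (×1-homo-* m n))
    *-distribˡ-minus : ∀ x y z → x * (y - z) ≈ x * y - x * z
    *-distribˡ-minus x y z = trans (distribˡ _ _ _) (+-congˡ (sym (-‿distribʳ-* _ _)))

  morphism : integers -Raw-AlmostCommutative⟶ fromCommutativeRing R
  morphism = record
    { ⟦_⟧    = ⟦_⟧ᶻ
    ; +-homo = λ y z → via (y ℤ.+ z) (trans (difference-+ y z) (sym (+-cong (⟦⟧≈difference y) (⟦⟧≈difference z))))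
    ; *-homo = λ y z → via (y ℤ.* z) (trans (difference-* y z) (sym (*-cong (⟦⟧≈difference y) (⟦⟧≈difference z))))
    ; -‿homo = λ z → via (ℤ.- z) (trans (difference-neg z) (-‿cong (sym (⟦⟧≈difference z))))
    ; 0-homo = refl
    ; 1-homo = refl
    }
    where
    via : ∀ z {x} → difference z ≈ x → ⟦ z ⟧ᶻ ≈ x
    via z = trans (⟦⟧≈difference z)

  -- Two pairs stand for the same integer when `a + b′` equals `a′ + b`; the proof adds `b′` to both
  -- entries of the first pair and `b` to both entries of the second.
  ⟦⟧-weaklyDecidable : ∀ y z → Maybe (⟦ y ⟧ᶻ ≈ ⟦ z ⟧ᶻ)
  ⟦⟧-weaklyDecidable y@(a , b) z@(a′ , b′) with a ℕ.+ b′ ℕₚ.≟ a′ ℕ.+ b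
  ... | no _  = nothing
  ... | yes e = just (begin
    ⟦ y ⟧ᶻ                    ≈⟨ ⟦⟧≈difference y ⟩
    a · 1# - b · 1#           ≈⟨ difference-cancel (a · 1#) (b · 1#) (b′ · 1#) ⟨
    (a · 1# + b′ · 1#) - (b · 1# + b′ · 1#) ≈⟨ +-congʳ (trans (sym (×-homo-+ 1# a b′)) (trans (reflexive (≡.cong (_· 1#) e)) (×-homo-+ 1# a′ b))) ⟩
    (a′ · 1# + b · 1#) - (b · 1# + b′ · 1#) ≈⟨ +-congˡ (-‿cong (+-comm _ _)) ⟩
    (a′ · 1# + b · 1#) - (b′ · 1# + b · 1#) ≈⟨ difference-cancel _ _ _ ⟩
    a′ · 1# - b′ · 1#         ≈⟨ ⟦⟧≈difference z ⟨
    ⟦ z ⟧ᶻ                    ∎)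

  open RingSolver integers (fromCommutativeRing R) morphism ⟦⟧-weaklyDecidable public
    using (Polynomial; solve; _:=_; _:+_; _:*_; :-_; _:-_; con)

  :0 :1 : ∀ {n} → Polynomial n
  :0 = con (0 , 0)
  :1 = con (1 , 0)

-- Formal power series over the reals

module FormalPowerSeries {c ℓ₁ ℓ₂ ℓ₃} (R : RealNumbers c ℓ₁ ℓ₂ ℓ₃) where
  open RealNumbers R hiding (zero)
  open Analysis R
  open Sum semiring using (sum-cong-≋; ∑-distrib-+; *-distribˡ-sum)
  open Mult semiring using (×1-homo-*)
  open import Algebra.Apartness.Properties.HeytingCommutativeRing
    heytingCommutativeRing using (x-0≈x)
  open IntegerSolver commutativeRing
  open SetoidReasoning setoid

  fromℕ-* : ∀ m n → fromℕ (m ℕ.* n) ≈ fromℕ m * fromℕ n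
  fromℕ-* = ×1-homo-*

  inverseʳ : ∀ x (x#0 : x # 0#) → x * inverse x x#0 ≈ 1#
  inverseʳ x x#0 = trans (*-congʳ (sym (x-0≈x x))) (proj₂ (proj₂ (#⇒invertible x#0)))

  *-cancelˡ-# : ∀ {x a b} → x # 0# → x * a ≈ x * b → a ≈ b
  *-cancelˡ-# {x} {a} {b} x#0 xa≈xb = begin
    a                     ≈⟨ expand a ⟩
    inverse x x#0 * (x * a) ≈⟨ *-congˡ xa≈xb ⟩
    inverse x x#0 * (x * b) ≈⟨ expand b ⟨
    b                     ∎
    where
    expand : ∀ y → y ≈ inverse x x#0 * (x * y)
    expand y = begin
      y                       ≈⟨ *-identityˡ y ⟨
      1# * y                  ≈⟨ *-congʳ (inverseʳ x x#0) ⟨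
      x * inverse x x#0 * y   ≈⟨ solve 3 (λ x i y → x :* i :* y := i :* (x :* y)) refl x _ y ⟩
      inverse x x#0 * (x * y) ∎

  n*[x/n] : ∀ x n .{{_ : NonZero n}} → fromℕ n * (x / n) ≈ x
  n*[x/n] x n = begin
    fromℕ n * (x * inverse (fromℕ n) _) ≈⟨ solve 3 (λ n x i → n :* (x :* i) := x :* (n :* i)) refl _ x _ ⟩
    x * (fromℕ n * inverse (fromℕ n) _) ≈⟨ *-congˡ (inverseʳ _ _) ⟩
    x * 1#                              ≈⟨ *-identityʳ x ⟩
    x                                   ∎

  fromℕ-cancelˡ : ∀ n .{{_ : NonZero n}} {a b} → fromℕ n * a ≈ fromℕ n * b → a ≈ b
  fromℕ-cancelˡ n = *-cancelˡ-# (fromℕ#0 n)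

  n!*[x/!n] : ∀ x n → fromℕ (n !) * (x /! n) ≈ x
  n!*[x/!n] x n = n*[x/n] x (n !) {{n ℕₚ.!≢0}}

  -- A quotient by `n !` is recognised by multiplying back, so the chosen inverse never has to be
  -- inspected.
  /!-unique : ∀ {x a} n → fromℕ (n !) * a ≈ x → a ≈ x /! n
  /!-unique {x} n n!a≈x = fromℕ-cancelˡ (n !) {{n ℕₚ.!≢0}} (trans n!a≈x (sym (n!*[x/!n] x n)))

  fromℕ-! : ∀ n → fromℕ (suc n !) ≈ fromℕ (suc n) * fromℕ (n !)
  fromℕ-! n = fromℕ-* (suc n) (n !)

  [1+n]*[x/![1+n]] : ∀ x n → fromℕ (suc n) * (x /! suc n) ≈ x /! n
  [1+n]*[x/![1+n]] x n = /!-unique n (begin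
    fromℕ (n !) * (fromℕ (suc n) * (x /! suc n)) ≈⟨ solve 3 (λ a b c → a :* (b :* c) := b :* a :* c) refl (fromℕ (n !)) (fromℕ (suc n)) (x /! suc n) ⟩
    fromℕ (suc n) * fromℕ (n !) * (x /! suc n)   ≈⟨ *-congʳ (fromℕ-! n) ⟨
    fromℕ (suc n !) * (x /! suc n)               ≈⟨ n!*[x/!n] x (suc n) ⟩
    x                                            ∎)

  x/!0≈x : ∀ x → x /! 0 ≈ x
  x/!0≈x x = sym (/!-unique 0 (solve 1 (λ x → (:1 :+ :0) :* x := x) refl x))

  infix 4 _≋_
  _≋_ : Series → Series → Set ℓ₁
  f ≋ g = ∀ n → f n ≈ g n

  infixl 6 _+ˢ_
  _+ˢ_ : Series → Series → Series
  (f +ˢ g) n = f n + g n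

  infix 8 -ˢ_
  -ˢ_ : Series → Series
  (-ˢ f) n = - f n

  zeroˢ : Series
  zeroˢ _ = 0#

  tail : Series → Series
  tail f n = f (suc n)

  infixr 7 _⋆_
  _⋆_ : Carrier → Series → Series
  (a ⋆ f) n = a * f n

  ⊛-cong : ∀ {f g h k} → f ≋ g → h ≋ k → f ⊛ h ≋ g ⊛ k
  ⊛-cong f≋g h≋k n = sum-cong-≋ {suc n} λ i → *-cong (f≋g (toℕ i)) (h≋k (n ∸ toℕ i))

  ⊛-distribʳ : ∀ h f g → (f +ˢ g) ⊛ h ≋ f ⊛ h +ˢ g ⊛ h
  ⊛-distribʳ h f g n = trans
    (sum-cong-≋ {suc n} λ i → distribʳ (h (n ∸ toℕ i)) (f (toℕ i)) (g (toℕ i)))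
    (∑-distrib-+ {suc n} (λ i → f (toℕ i) * h (n ∸ toℕ i)) (λ i → g (toℕ i) * h (n ∸ toℕ i)))

  ⋆-⊛ : ∀ a f g → (a ⋆ f) ⊛ g ≋ a ⋆ (f ⊛ g)
  ⋆-⊛ a f g n = trans
    (sum-cong-≋ {suc n} λ i → *-assoc a (f (toℕ i)) (g (n ∸ toℕ i)))
    (sym (*-distribˡ-sum {suc n} a (λ i → f (toℕ i) * g (n ∸ toℕ i))))

  ⊛-zeroˡ : ∀ f → zeroˢ ⊛ f ≋ zeroˢ
  ⊛-zeroˡ f n = begin
    (zeroˢ ⊛ f) n        ≈⟨ ⊛-cong {zeroˢ} {0# ⋆ zeroˢ} {f} {f} (λ _ → sym (zeroˡ 0#)) (λ _ → refl) n ⟩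
    ((0# ⋆ zeroˢ) ⊛ f) n ≈⟨ ⋆-⊛ 0# zeroˢ f n ⟩
    0# * (zeroˢ ⊛ f) n   ≈⟨ zeroˡ _ ⟩
    0#                   ∎

  ⊛-zero : ∀ f g → (f ⊛ g) 0 ≈ f 0 * g 0
  ⊛-zero f g = +-identityʳ _

  -- By computation `⊛` splits off the term with `f 0`; here the term with `g 0`, at the other end
  -- of the sum, is split off. Commutativity follows by comparing the two.
  ⊛-tailʳ : ∀ f g → tail (f ⊛ g) ≋ f ⊛ tail g +ˢ g 0 ⋆ tail f
  ⊛-tailʳ f g zero    = solve 4 (λ a b c d → a :* b :+ (c :* d :+ :0) := a :* b :+ :0 :+ d :* c) refl (f 0) (g 1) (f 1) (g 0)
  ⊛-tailʳ f g (suc n) = trans (+-congˡ (⊛-tailʳ (tail f) g n)) (sym (+-assoc _ _ _))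

  ⊛-comm : ∀ f g → f ⊛ g ≋ g ⊛ f
  ⊛-comm f g zero    = +-congʳ (*-comm (f 0) (g 0))
  ⊛-comm f g (suc n) = begin
    f 0 * g (suc n) + (tail f ⊛ g) n ≈⟨ +-comm _ _ ⟩
    (tail f ⊛ g) n + f 0 * g (suc n) ≈⟨ +-congʳ (⊛-comm (tail f) g n) ⟩
    (g ⊛ tail f) n + f 0 * g (suc n) ≈⟨ ⊛-tailʳ g f n ⟨
    (g ⊛ f) (suc n)                  ∎

  -- Induction on the coefficient: `tail (f ⊛ g)` unfolds to `f 0 ⋆ tail g +ˢ tail f ⊛ g`, and the
  -- second summand falls under the induction hypothesis.
  ⊛-assoc : ∀ f g h → (f ⊛ g) ⊛ h ≋ f ⊛ (g ⊛ h)
  ⊛-assoc f g h zero    = solve 3 (λ a b c → (a :* b :+ :0) :* c :+ :0 := a :* (b :* c :+ :0) :+ :0) refl (f 0) (g 0) (h 0)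
  ⊛-assoc f g h (suc n) = begin
    (f ⊛ g) 0 * h (suc n) + (tail (f ⊛ g) ⊛ h) n
      ≈⟨ +-cong (*-congʳ (⊛-zero f g)) (⊛-distribʳ h (f 0 ⋆ tail g) (tail f ⊛ g) n) ⟩
    f 0 * g 0 * h (suc n) + (((f 0 ⋆ tail g) ⊛ h) n + ((tail f ⊛ g) ⊛ h) n)
      ≈⟨ +-congˡ (+-cong (⋆-⊛ (f 0) (tail g) h n) (⊛-assoc (tail f) g h n)) ⟩
    f 0 * g 0 * h (suc n) + (f 0 * (tail g ⊛ h) n + (tail f ⊛ (g ⊛ h)) n)
      ≈⟨ solve 5 (λ a b c d e → a :* b :* c :+ (a :* d :+ e) := a :* (b :* c :+ d) :+ e) refl (f 0) (g 0) (h (suc n)) _ _ ⟩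
    f 0 * (g ⊛ h) (suc n) + (tail f ⊛ (g ⊛ h)) n ∎

  ⊛-identityˡ : ∀ f → oneˢ ⊛ f ≋ f
  ⊛-identityˡ f zero    = trans (⊛-zero oneˢ f) (*-identityˡ _)
  ⊛-identityˡ f (suc n) = begin
    1# * f (suc n) + (zeroˢ ⊛ f) n ≈⟨ +-congˡ (⊛-zeroˡ f n) ⟩
    1# * f (suc n) + 0#            ≈⟨ solve 1 (λ x → :1 :* x :+ :0 := x) refl _ ⟩
    f (suc n)                      ∎

  -- Sealed, so that products of series are not unfolded to finite sums when
  -- equations are checked.
  opaque
    infixl 7 _✶_
    _✶_ : Series → Series → Series
    _✶_ = _⊛_

    ✶≋⊛ : ∀ f g → f ✶ g ≋ f ⊛ g
    ✶≋⊛ f g n = refl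

    ✶-cong : ∀ {f g h k} → f ≋ g → h ≋ k → f ✶ h ≋ g ✶ k
    ✶-cong = ⊛-cong

    ✶-distribʳ : ∀ h f g → (f +ˢ g) ✶ h ≋ f ✶ h +ˢ g ✶ h
    ✶-distribʳ = ⊛-distribʳ

    ✶-comm : ∀ f g → f ✶ g ≋ g ✶ f
    ✶-comm = ⊛-comm

    ✶-assoc : ∀ f g h → (f ✶ g) ✶ h ≋ f ✶ (g ✶ h)
    ✶-assoc = ⊛-assoc

    ✶-identityˡ : ∀ f → oneˢ ✶ f ≋ f
    ✶-identityˡ = ⊛-identityˡ

    ✶-zero : ∀ f g → (f ✶ g) 0 ≈ f 0 * g 0
    ✶-zero f g = +-identityʳ _

    ✶-tail : ∀ f g → tail (f ✶ g) ≋ f 0 ⋆ tail g +ˢ tail f ✶ g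
    ✶-tail f g n = refl

    ⋆-✶ : ∀ a f g → (a ⋆ f) ✶ g ≋ a ⋆ (f ✶ g)
    ⋆-✶ = ⋆-⊛

  isCommutativeRing-✶ : IsCommutativeRing _≋_ _+ˢ_ _✶_ -ˢ_ zeroˢ oneˢ
  isCommutativeRing-✶ = record
    { isRing = record
      { +-isAbelianGroup = record
        { isGroup = record
          { isMonoid = record
            { isSemigroup = record
              { isMagma = record
                { isEquivalence = record
                  { refl  = λ n → refl
                  ; sym   = λ f≋g n → sym (f≋g n)
                  ; trans = λ f≋g g≋h n → trans (f≋g n) (g≋h n)
                  }
                ; ∙-cong = λ f≋g h≋k n → +-cong (f≋g n) (h≋k n)
                }
              ; assoc = λ f g h n → +-assoc (f n) (g n) (h n)
              }
            ; identity = (λ f n → +-identityˡ (f n)) , (λ f n → +-identityʳ (f n))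
            }
          ; inverse = (λ f n → -‿inverseˡ (f n)) , (λ f n → -‿inverseʳ (f n))
          ; ⁻¹-cong = λ f≋g n → -‿cong (f≋g n)
          }
        ; comm = λ f g n → +-comm (f n) (g n)
        }
      ; *-cong = ✶-cong
      ; *-assoc = ✶-assoc
      ; *-identity = ✶-identityˡ , (λ f n → trans (✶-comm f oneˢ n) (✶-identityˡ f n))
      ; distrib = (λ h f g n → trans (✶-comm h (f +ˢ g) n) (trans (✶-distribʳ h f g n) (+-cong (✶-comm f h n) (✶-comm g h n))))
                , ✶-distribʳ
      }
    ; *-comm = ✶-comm
    }

  seriesRing : CommutativeRing c ℓ₁
  seriesRing = record { isCommutativeRing = isCommutativeRing-✶ }
  module S = CommutativeRing seriesRing

  -- Scalars as constant series: scalar multiples become products in `seriesRing`, where the ring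
  -- solver can treat them.
  const : Carrier → Series
  const a = a ⋆ oneˢ

  const-✶ : ∀ a f → const a ✶ f ≋ a ⋆ f
  const-✶ a f n = trans (⋆-✶ a oneˢ f n) (*-congˡ (✶-identityˡ f n))

  -- Multiplication by t and the derivation t d/dt

  X : Series
  X zero    = 0#
  X (suc n) = oneˢ n

  X✶-zero : ∀ f → (X ✶ f) 0 ≈ 0#
  X✶-zero f = trans (✶-zero X f) (zeroˡ _)

  X✶-suc : ∀ f n → (X ✶ f) (suc n) ≈ f n
  X✶-suc f n = begin
    (X ✶ f) (suc n)              ≈⟨ ✶-tail X f n ⟩
    0# * f (suc n) + (oneˢ ✶ f) n ≈⟨ +-congˡ (✶-identityˡ f n) ⟩
    0# * f (suc n) + f n         ≈⟨ solve 2 (λ x y → :0 :* x :+ y := y) refl _ _ ⟩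
    f n                          ∎

  X-cancelˡ : ∀ {f g} → X ✶ f ≋ X ✶ g → f ≋ g
  X-cancelˡ {f} {g} Xf≋Xg n = trans (sym (X✶-suc f n)) (trans (Xf≋Xg (suc n)) (X✶-suc g n))

  θ : Series → Series
  θ f n = fromℕ n * f n

  θ-cong : ∀ {f g} → f ≋ g → θ f ≋ θ g
  θ-cong f≋g n = *-congˡ (f≋g n)

  θ-tail : ∀ f → tail (θ f) ≋ tail f +ˢ θ (tail f)
  θ-tail f n = solve 2 (λ n x → (:1 :+ n) :* x := x :+ n :* x) refl (fromℕ n) (f (suc n))

  -- Of the `suc n` copies of `(tail f ✶ g) n`, `n` go to the induction hypothesis, and the
  -- remaining one is the extra summand by which `tail (θ f)` exceeds `θ (tail f)`.
  θ-✶ : ∀ f g → θ (f ✶ g) ≋ θ f ✶ g +ˢ f ✶ θ g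
  θ-✶ f g zero    = begin
    0# * (f ✶ g) 0                        ≈⟨ solve 3 (λ x a b → :0 :* x := :0 :* a :* b :+ a :* (:0 :* b)) refl _ (f 0) (g 0) ⟩
    0# * f 0 * g 0 + f 0 * (0# * g 0)     ≈⟨ +-cong (✶-zero (θ f) g) (✶-zero f (θ g)) ⟨
    (θ f ✶ g) 0 + (f ✶ θ g) 0             ∎
  θ-✶ f g (suc n) = begin
    fromℕ (suc n) * (f ✶ g) (suc n)
      ≈⟨ *-congˡ (✶-tail f g n) ⟩
    fromℕ (suc n) * (f 0 * g (suc n) + (tail f ✶ g) n)
      ≈⟨ solve 4 (λ n a b x → (:1 :+ n) :* (a :* b :+ x) := n :* x :+ (x :+ a :* ((:1 :+ n) :* b))) refl (fromℕ n) (f 0) (g (suc n)) _ ⟩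
    fromℕ n * (tail f ✶ g) n + ((tail f ✶ g) n + f 0 * θ g (suc n))
      ≈⟨ +-congʳ (θ-✶ (tail f) g n) ⟩
    ((θ (tail f) ✶ g) n + (tail f ✶ θ g) n) + ((tail f ✶ g) n + f 0 * θ g (suc n))
      ≈⟨ solve 6 (λ x y z w a b → (x :+ y) :+ (z :+ w) := (:0 :* a :* b :+ (z :+ x)) :+ (w :+ y)) refl _ _ _ _ (f 0) (g (suc n)) ⟩
    (0# * f 0 * g (suc n) + ((tail f ✶ g) n + (θ (tail f) ✶ g) n)) + (f 0 * θ g (suc n) + (tail f ✶ θ g) n)
      ≈⟨ +-cong (+-congˡ (trans (✶-cong (θ-tail f) S.refl n) (✶-distribʳ g (tail f) (θ (tail f)) n))) (✶-tail f (θ g) n) ⟨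
    (0# * f 0 * g (suc n) + (tail (θ f) ✶ g) n) + (f ✶ θ g) (suc n)
      ≈⟨ +-congʳ (✶-tail (θ f) g n) ⟨
    (θ f ✶ g) (suc n) + (f ✶ θ g) (suc n) ∎

  θ-one : θ oneˢ ≋ zeroˢ
  θ-one zero    = zeroˡ _
  θ-one (suc n) = zeroʳ _

  -- Exponential series

  exp-zero : ∀ x → expˢ x 0 ≈ 1#
  exp-zero x = x/!0≈x 1#

  exp-suc : ∀ x n → fromℕ (suc n) * expˢ x (suc n) ≈ x * expˢ x n
  exp-suc x n = trans ([1+n]*[x/![1+n]] (x ^ suc n) n) (*-assoc x (x ^ n) _)

  θ-exp : ∀ x → θ (expˢ x) ≋ const x ✶ (X ✶ expˢ x)
  θ-exp x n = trans (coefficient n) (sym (const-✶ x (X ✶ expˢ x) n))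
    where
    coefficient : ∀ n → θ (expˢ x) n ≈ x * (X ✶ expˢ x) n
    coefficient zero    = trans (zeroˡ _) (sym (trans (*-congˡ (X✶-zero (expˢ x))) (zeroʳ x)))
    coefficient (suc n) = trans (exp-suc x n) (*-congˡ (sym (X✶-suc (expˢ x) n)))

  -- The equation t f′ = x t f fixes each coefficient from the previous one, because `fromℕ (suc n)`
  -- can be cancelled.
  exp-unique : ∀ {x f} → f 0 ≈ 1# → θ f ≋ const x ✶ (X ✶ f) → f ≋ expˢ x
  exp-unique {x} {f} f₀≈1 θf zero    = trans f₀≈1 (sym (exp-zero x))
  exp-unique {x} {f} f₀≈1 θf (suc n) = fromℕ-cancelˡ (suc n) (begin
    fromℕ (suc n) * f (suc n)       ≈⟨ θf (suc n) ⟩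
    (const x ✶ (X ✶ f)) (suc n)     ≈⟨ const-✶ x (X ✶ f) (suc n) ⟩
    x * (X ✶ f) (suc n)             ≈⟨ *-congˡ (X✶-suc f n) ⟩
    x * f n                         ≈⟨ *-congˡ (exp-unique {x} {f} f₀≈1 θf n) ⟩
    x * expˢ x n                    ≈⟨ exp-suc x n ⟨
    fromℕ (suc n) * expˢ x (suc n)  ∎)

  -- The coefficients `σ ^ n * expm1/tˢ n` are those of (e^{σt} - 1)/(σt), written without dividing
  -- by σ. The values 1 and -1 of σ are used.
  exp-1-one : ∀ σ → const σ ✶ (X ✶ λ n → σ ^ n * expm1/tˢ n) ≋ expˢ σ S.- oneˢ
  exp-1-one σ n = trans (const-✶ σ (X ✶ λ n → σ ^ n * expm1/tˢ n) n) (coefficient n)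
    where
    coefficient : ∀ n → σ * (X ✶ λ n → σ ^ n * expm1/tˢ n) n ≈ expˢ σ n - oneˢ n
    coefficient zero    = begin
      σ * (X ✶ λ n → σ ^ n * expm1/tˢ n) 0 ≈⟨ *-congˡ (X✶-zero _) ⟩
      σ * 0#         ≈⟨ solve 1 (λ s → s :* :0 := :1 :- :1) refl σ ⟩
      1# - 1#        ≈⟨ +-congʳ (exp-zero σ) ⟨
      expˢ σ 0 - 1#  ∎
    coefficient (suc n) = begin
      σ * (X ✶ λ n → σ ^ n * expm1/tˢ n) (suc n) ≈⟨ *-congˡ (X✶-suc _ n) ⟩
      σ * (σ ^ n * (1# * _))     ≈⟨ solve 3 (λ s p i → s :* (p :* (:1 :* i)) := s :* p :* i :- :0) refl σ (σ ^ n) _ ⟩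
      expˢ σ (suc n) - 0#        ∎

  1^n≈1 : ∀ n → 1# ^ n ≈ 1#
  1^n≈1 zero    = refl
  1^n≈1 (suc n) = trans (*-identityˡ _) (1^n≈1 n)

  X✶expm1/t : X ✶ expm1/tˢ ≋ expˢ 1# S.- oneˢ
  X✶expm1/t = S.trans
    (S.trans (S.*-congˡ {X} λ n → sym (trans (*-congʳ (1^n≈1 n)) (*-identityˡ _)))
             (λ n → sym (trans (const-✶ 1# _ n) (*-identityˡ _))))
    (exp-1-one 1#)

  -- Writing E for the series, differentiation of t E = e^t - 1 gives E + θ E = e^t = 1 + t E. On
  -- coefficients this is `[1+n]*[x/![1+n]]`.
  θ-expm1/t : θ expm1/tˢ ≋ oneˢ +ˢ X ✶ expm1/tˢ S.- expm1/tˢ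
  θ-expm1/t zero    = begin
    0# * expm1/tˢ 0                       ≈⟨ solve 1 (λ x → :0 :* x := :1 :+ :0 :- :1) refl _ ⟩
    1# + 0# - 1#                          ≈⟨ +-cong (+-congˡ (X✶-zero expm1/tˢ)) (-‿cong (x/!0≈x 1#)) ⟨
    1# + (X ✶ expm1/tˢ) 0 - expm1/tˢ 0    ∎
  θ-expm1/t (suc n) = begin
    fromℕ (suc n) * expm1/tˢ (suc n)
      ≈⟨ solve 2 (λ n x → (:1 :+ n) :* x := :0 :+ (:1 :+ (:1 :+ n)) :* x :- x) refl (fromℕ n) (expm1/tˢ (suc n)) ⟩
    0# + fromℕ (suc (suc n)) * expm1/tˢ (suc n) - expm1/tˢ (suc n)
      ≈⟨ +-congʳ (+-congˡ (trans ([1+n]*[x/![1+n]] 1# (suc n)) (sym (X✶-suc expm1/tˢ n)))) ⟩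
    0# + (X ✶ expm1/tˢ) (suc n) - expm1/tˢ (suc n) ∎

  -- The series (e^{st} - 1 - st)/(st)², whose coefficients are polynomials in `s`, so that they
  -- stay bounded for bounded `s` and make sense at 0.
  expRemainder : Carrier → Series
  expRemainder s n = s ^ n /! suc (suc n)

  exp-taylor : ∀ s → expˢ s ≋ oneˢ +ˢ s ⋆ X +ˢ (s * s) ⋆ (X ✶ (X ✶ expRemainder s))
  exp-taylor s zero = begin
    expˢ s 0  ≈⟨ exp-zero s ⟩
    1#        ≈⟨ solve 1 (λ s → :1 := :1 :+ s :* :0 :+ s :* s :* :0) refl s ⟩
    1# + s * 0# + s * s * 0# ≈⟨ +-congˡ (*-congˡ (X✶-zero _)) ⟨
    1# + s * 0# + s * s * (X ✶ (X ✶ expRemainder s)) 0 ∎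
  exp-taylor s (suc zero) = begin
    expˢ s 1      ≈⟨ fromℕ-cancelˡ 1 (trans (exp-suc s 0) (trans (*-congˡ (exp-zero s)) (solve 1 (λ s → s :* :1 := (:1 :+ :0) :* s) refl s))) ⟩
    s             ≈⟨ solve 1 (λ s → s := :0 :+ s :* :1 :+ s :* s :* :0) refl s ⟩
    0# + s * 1# + s * s * 0# ≈⟨ +-congˡ (*-congˡ (trans (X✶-suc _ 0) (X✶-zero _))) ⟨
    0# + s * 1# + s * s * (X ✶ (X ✶ expRemainder s)) 1 ∎
  exp-taylor s (suc (suc n)) = begin
    s * (s * s ^ n) * _
      ≈⟨ solve 3 (λ s p i → s :* (s :* p) :* i := :0 :+ s :* :0 :+ s :* s :* (p :* i)) refl s (s ^ n) _ ⟩
    0# + s * 0# + s * s * expRemainder s n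
      ≈⟨ +-congˡ (*-congˡ (trans (X✶-suc _ (suc n)) (X✶-suc _ n))) ⟨
    0# + s * 0# + s * s * (X ✶ (X ✶ expRemainder s)) (suc (suc n)) ∎

  -- Multiplication by t^i, which is the effect of i differentiations in y on e^{yt}. Its vanishing
  -- coefficients below `i` account for the empty sums.
  shift : ℕ → Series → Series
  shift zero    f = f
  shift (suc i) f = X ✶ shift i f

  shift-< : ∀ {i n} f → n ℕ.< i → shift i f n ≈ 0#
  shift-< {suc i} {zero}  f _           = X✶-zero (shift i f)
  shift-< {suc i} {suc n} f (ℕ.s≤s n<i) = trans (X✶-suc (shift i f) n) (shift-< f n<i)

  shift-≤ : ∀ {i n} f → i ℕ.≤ n → shift i f n ≈ f (n ∸ i)
  shift-≤ {zero}          f _           = refl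
  shift-≤ {suc i} {suc n} f (ℕ.s≤s i≤n) = trans (X✶-suc (shift i f) n) (shift-≤ f i≤n)

  shift-cong : ∀ i {f g} → f ≋ g → shift i f ≋ shift i g
  shift-cong zero    f≋g = f≋g
  shift-cong (suc i) f≋g = S.*-congˡ (shift-cong i f≋g)

-- Generating series of the higher-order Bernoulli polynomials

module BernoulliSeries {c ℓ₁ ℓ₂ ℓ₃} (R : RealNumbers c ℓ₁ ℓ₂ ℓ₃) where
  open RealNumbers R hiding (zero)
  open Analysis R
  open FormalPowerSeries R
  open IntegerSolver seriesRing
  private module ℝ = IntegerSolver commutativeRing
  open SetoidReasoning S.setoid

  const-+ : ∀ x y → const (x + y) ≋ const x +ˢ const y
  const-+ x y n = distribʳ (oneˢ n) x y

  -- By the Leibniz rule the product solves the differential equation that characterises e^{(x+y)t}.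
  exp-+ : ∀ x y → expˢ (x + y) ≋ expˢ x ✶ expˢ y
  exp-+ x y = S.sym (exp-unique constant (begin
    θ (expˢ x ✶ expˢ y)
      ≈⟨ θ-✶ (expˢ x) (expˢ y) ⟩
    θ (expˢ x) ✶ expˢ y +ˢ expˢ x ✶ θ (expˢ y)
      ≈⟨ S.+-cong (S.*-congʳ (θ-exp x)) (S.*-congˡ (θ-exp y)) ⟩
    const x ✶ (X ✶ expˢ x) ✶ expˢ y +ˢ expˢ x ✶ (const y ✶ (X ✶ expˢ y))
      ≈⟨ solve 5 (λ a b X e f → a :* (X :* e) :* f :+ e :* (b :* (X :* f)) := (a :+ b) :* (X :* (e :* f)))
           S.refl (const x) (const y) X (expˢ x) (expˢ y) ⟩
    (const x +ˢ const y) ✶ (X ✶ (expˢ x ✶ expˢ y))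
      ≈⟨ S.*-congʳ (const-+ x y) ⟨
    const (x + y) ✶ (X ✶ (expˢ x ✶ expˢ y)) ∎))
    where
    constant : (expˢ x ✶ expˢ y) 0 ≈ 1#
    constant = trans (✶-zero (expˢ x) (expˢ y)) (trans (*-cong (exp-zero x) (exp-zero y)) (*-identityˡ 1#))

  exp-cong : ∀ {x y} → x ≈ y → expˢ x ≋ expˢ y
  exp-cong x≈y n = *-congʳ (^-cong n)
    where
    ^-cong : ∀ n → _ ^ n ≈ _ ^ n
    ^-cong zero    = refl
    ^-cong (suc n) = *-cong x≈y (^-cong n)

  E : Series
  E = expm1/tˢ

  r : Series
  r = reciprocal E

  E✶r≋1 : E ✶ r ≋ oneˢ
  E✶r≋1 = S.trans (✶≋⊛ E r) expm1/tˢ-reciprocal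

  -- Applying θ to E r = 1 gives θ r = - r (r θ E), and `θ-expm1/t` together with E r = 1 turns r θ
  -- E into r + t - 1.
  θ-r : θ r ≋ r ✶ (oneˢ S.- r S.- X)
  θ-r = begin
    θ r
      ≈⟨ S.*-identityˡ _ ⟨
    oneˢ ✶ θ r
      ≈⟨ S.*-congʳ E✶r≋1 ⟨
    E ✶ r ✶ θ r
      ≈⟨ solve 4 (λ E r θE θr → E :* r :* θr := r :* ((θE :* r :+ E :* θr) :- θE :* r)) S.refl E r (θ E) (θ r) ⟩
    r ✶ ((θ E ✶ r +ˢ E ✶ θ r) S.- θ E ✶ r)
      ≈⟨ S.*-congˡ (S.+-cong (S.trans (S.sym (θ-✶ E r)) (S.trans (θ-cong E✶r≋1) θ-one)) (S.-‿cong (S.*-congʳ θ-expm1/t))) ⟩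
    r ✶ (zeroˢ S.- (oneˢ +ˢ X ✶ E S.- E) ✶ r)
      ≈⟨ solve 3 (λ E r X → r :* (:0 :- (:1 :+ X :* E :- E) :* r) := r :* (E :* r :- r :- X :* (E :* r))) S.refl E r X ⟩
    r ✶ (E ✶ r S.- r S.- X ✶ (E ✶ r))
      ≈⟨ S.*-congˡ (S.+-cong (S.+-congʳ E✶r≋1) (S.-‿cong (S.*-congˡ E✶r≋1))) ⟩
    r ✶ (oneˢ S.- r S.- X ✶ oneˢ)
      ≈⟨ S.*-congˡ (S.+-congˡ (S.-‿cong (S.*-identityʳ X))) ⟩
    r ✶ (oneˢ S.- r S.- X) ∎

  r^-suc : ∀ α → r ^ˢ suc α ≋ r ✶ r ^ˢ α
  r^-suc α = S.sym (✶≋⊛ r (r ^ˢ α))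

  θ-r^ : ∀ α → θ (r ^ˢ α) ≋ const (fromℕ α) ✶ (r ^ˢ α ✶ (oneˢ S.- r S.- X))
  θ-r^ zero    = S.trans θ-one (S.sym (λ n → trans (const-✶ 0# (oneˢ ✶ (oneˢ S.- r S.- X)) n) (zeroˡ _)))
  θ-r^ (suc α) = begin
    θ (r ^ˢ suc α)
      ≈⟨ θ-cong (r^-suc α) ⟩
    θ (r ✶ r ^ˢ α)
      ≈⟨ θ-✶ r (r ^ˢ α) ⟩
    θ r ✶ r ^ˢ α +ˢ r ✶ θ (r ^ˢ α)
      ≈⟨ S.+-cong (S.*-congʳ θ-r) (S.*-congˡ (θ-r^ α)) ⟩
    r ✶ (oneˢ S.- r S.- X) ✶ r ^ˢ α +ˢ r ✶ (const (fromℕ α) ✶ (r ^ˢ α ✶ (oneˢ S.- r S.- X)))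
      ≈⟨ solve 4 (λ r p d c → r :* d :* p :+ r :* (c :* (p :* d)) := (:1 :+ c) :* (r :* p :* d)) S.refl r (r ^ˢ α) (oneˢ S.- r S.- X) (const (fromℕ α)) ⟩
    (oneˢ +ˢ const (fromℕ α)) ✶ (r ✶ r ^ˢ α ✶ (oneˢ S.- r S.- X))
      ≈⟨ S.*-cong (S.trans (const-+ 1# (fromℕ α)) (S.+-congʳ λ n → *-identityˡ (oneˢ n))) (S.*-congʳ (r^-suc α)) ⟨
    const (fromℕ (suc α)) ✶ (r ^ˢ suc α ✶ (oneˢ S.- r S.- X)) ∎

  B : ℕ → Carrier → Series
  B α x = r ^ˢ α ✶ expˢ x

  B-cong : ∀ α {x y} → x ≈ y → B α x ≋ B α y
  B-cong α x≈y = S.*-congˡ (exp-cong x≈y)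

  B-+ : ∀ α x y → B α (x + y) ≋ expˢ y ✶ B α x
  B-+ α x y = S.trans (S.*-congˡ (exp-+ x y)) (solve 3 (λ r e f → r :* (e :* f) := f :* (r :* e)) S.refl (r ^ˢ α) (expˢ x) (expˢ y))

  B-suc : ∀ α x → B (suc α) x ≋ r ✶ B α x
  B-suc α x = S.trans (S.*-congʳ (r^-suc α)) (S.*-assoc r (r ^ˢ α) (expˢ x))

  B-suc-✶E : ∀ α x → B (suc α) x ✶ E ≋ B α x
  B-suc-✶E α x = begin
    B (suc α) x ✶ E   ≈⟨ S.*-congʳ (B-suc α x) ⟩
    r ✶ B α x ✶ E     ≈⟨ solve 3 (λ r b e → r :* b :* e := e :* r :* b) S.refl r (B α x) E ⟩
    E ✶ r ✶ B α x     ≈⟨ S.*-congʳ E✶r≋1 ⟩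
    oneˢ ✶ B α x      ≈⟨ S.*-identityˡ _ ⟩
    B α x             ∎

  E⁻ : Series
  E⁻ n = (- 1#) ^ n * E n

  exp✶E⁻ : expˢ 1# ✶ E⁻ ≋ E
  exp✶E⁻ = X-cancelˡ (begin
    X ✶ (expˢ 1# ✶ E⁻)
      ≈⟨ solve 3 (λ X e E → X :* (e :* E) := :- (e :* (:- :1 :* (X :* E)))) S.refl X (expˢ 1#) E⁻ ⟩
    -ˢ (expˢ 1# ✶ (-ˢ oneˢ ✶ (X ✶ E⁻)))
      ≈⟨ S.-‿cong (S.*-congˡ (S.*-congʳ -one)) ⟩
    -ˢ (expˢ 1# ✶ (const (- 1#) ✶ (X ✶ E⁻)))
      ≈⟨ S.-‿cong (S.*-congˡ (exp-1-one (- 1#))) ⟩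
    -ˢ (expˢ 1# ✶ (expˢ (- 1#) S.- oneˢ))
      ≈⟨ solve 2 (λ e f → :- (e :* (f :- :1)) := e :- e :* f) S.refl (expˢ 1#) (expˢ (- 1#)) ⟩
    expˢ 1# S.- expˢ 1# ✶ expˢ (- 1#)
      ≈⟨ S.+-congˡ {expˢ 1#} (S.-‿cong (S.trans (S.sym (exp-+ 1# (- 1#))) (S.trans (exp-cong (-‿inverseʳ 1#)) exp-0))) ⟩
    expˢ 1# S.- oneˢ
      ≈⟨ X✶expm1/t ⟨
    X ✶ E ∎)
    where
    -one : -ˢ oneˢ ≋ const (- 1#)
    -one n = ℝ.solve 1 (λ x → ℝ.:- x ℝ.:= (ℝ.:- ℝ.:1) ℝ.:* x) refl (oneˢ n)

    exp-0 : expˢ 0# ≋ oneˢ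
    exp-0 zero    = exp-zero 0#
    exp-0 (suc n) = trans (*-congʳ (zeroˡ _)) (zeroˡ _)

  B-suc-✶E⁻ : ∀ α x → B (suc α) (x + 1#) ✶ E⁻ ≋ B α x
  B-suc-✶E⁻ α x = begin
    B (suc α) (x + 1#) ✶ E⁻         ≈⟨ S.*-congʳ (B-+ (suc α) x 1#) ⟩
    expˢ 1# ✶ B (suc α) x ✶ E⁻      ≈⟨ solve 3 (λ e b f → e :* b :* f := b :* (e :* f)) S.refl (expˢ 1#) (B (suc α) x) E⁻ ⟩
    B (suc α) x ✶ (expˢ 1# ✶ E⁻)    ≈⟨ S.*-congˡ exp✶E⁻ ⟩
    B (suc α) x ✶ E                 ≈⟨ B-suc-✶E α x ⟩
    B α x                           ∎

  -- The difference pulls out e^t - 1 = t E, and E cancels one of the factors r.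
  B-difference : ∀ α x → B (suc α) (x + 1#) S.- B (suc α) x ≋ X ✶ B α x
  B-difference α x = begin
    B (suc α) (x + 1#) S.- B (suc α) x      ≈⟨ S.+-congʳ (B-+ (suc α) x 1#) ⟩
    expˢ 1# ✶ B (suc α) x S.- B (suc α) x   ≈⟨ solve 2 (λ e b → e :* b :- b := (e :- :1) :* b) S.refl (expˢ 1#) (B (suc α) x) ⟩
    (expˢ 1# S.- oneˢ) ✶ B (suc α) x        ≈⟨ S.*-congʳ X✶expm1/t ⟨
    X ✶ E ✶ B (suc α) x                     ≈⟨ solve 3 (λ X e b → X :* e :* b := X :* (b :* e)) S.refl X E (B (suc α) x) ⟩
    X ✶ (B (suc α) x ✶ E)                   ≈⟨ S.*-congˡ (B-suc-✶E α x) ⟩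
    X ✶ B α x                               ∎

  -- The Leibniz rule on r^α e^{xt}; the order rises to `suc α` because `θ-r^` contains an
  -- additional factor r.
  θ-B : ∀ α x → θ (B α x) ≋ const (fromℕ α) ✶ (B α x S.- B (suc α) x S.- X ✶ B α x) +ˢ const x ✶ (X ✶ B α x)
  θ-B α x = begin
    θ (B α x)
      ≈⟨ θ-✶ (r ^ˢ α) (expˢ x) ⟩
    θ (r ^ˢ α) ✶ expˢ x +ˢ r ^ˢ α ✶ θ (expˢ x)
      ≈⟨ S.+-cong (S.*-congʳ (θ-r^ α)) (S.*-congˡ (θ-exp x)) ⟩
    const (fromℕ α) ✶ (r ^ˢ α ✶ (oneˢ S.- r S.- X)) ✶ expˢ x +ˢ r ^ˢ α ✶ (const x ✶ (X ✶ expˢ x))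
      ≈⟨ solve 6 (λ c p r X e x → c :* (p :* (:1 :- r :- X)) :* e :+ p :* (x :* (X :* e)) := c :* (p :* e :- r :* (p :* e) :- X :* (p :* e)) :+ x :* (X :* (p :* e)))
           S.refl (const (fromℕ α)) (r ^ˢ α) r X (expˢ x) (const x) ⟩
    const (fromℕ α) ✶ (B α x S.- r ✶ B α x S.- X ✶ B α x) +ˢ const x ✶ (X ✶ B α x)
      ≈⟨ S.+-congʳ (S.*-congˡ (S.+-congʳ (S.+-congˡ {B α x} (S.-‿cong (B-suc α x))))) ⟨
    const (fromℕ α) ✶ (B α x S.- B (suc α) x S.- X ✶ B α x) +ˢ const x ✶ (X ✶ B α x) ∎

  shift-✶ : ∀ i f g → shift i (f ✶ g) ≋ f ✶ shift i g
  shift-✶ zero    f g = S.refl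
  shift-✶ (suc i) f g = begin
    X ✶ shift i (f ✶ g)  ≈⟨ S.*-congˡ (shift-✶ i f g) ⟩
    X ✶ (f ✶ shift i g)  ≈⟨ solve 3 (λ X f g → X :* (f :* g) := f :* (X :* g)) S.refl X f (shift i g) ⟩
    f ✶ (X ✶ shift i g)  ∎

  -- Moving the argument by `s` multiplies by e^{st}, which `exp-taylor` expands to second order.
  -- The linear term exhibits `shift (suc i)` as the derivative of `shift i`, and the remainder is
  -- explicit.
  shift-B-taylor : ∀ i α x s → shift i (B α (x + s)) ≋
    shift i (B α x) +ˢ s ⋆ shift (suc i) (B α x) +ˢ (s * s) ⋆ (expRemainder s ✶ shift (suc (suc i)) (B α x))
  shift-B-taylor i α x s = begin
    shift i (B α (x + s))
      ≈⟨ shift-cong i (B-+ α x s) ⟩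
    shift i (expˢ s ✶ B α x)
      ≈⟨ shift-✶ i (expˢ s) (B α x) ⟩
    expˢ s ✶ b
      ≈⟨ S.*-congʳ (S.trans (exp-taylor s) (S.+-cong (S.+-congˡ {oneˢ} (S.sym (const-✶ s X))) (S.sym (const-✶ (s * s) _)))) ⟩
    (oneˢ +ˢ const s ✶ X +ˢ const (s * s) ✶ (X ✶ (X ✶ expRemainder s))) ✶ b
      ≈⟨ solve 5 (λ s s² X e b → (:1 :+ s :* X :+ s² :* (X :* (X :* e))) :* b := b :+ s :* (X :* b) :+ s² :* (e :* (X :* (X :* b)))) S.refl (const s) (const (s * s)) X (expRemainder s) b ⟩
    b +ˢ const s ✶ (X ✶ b) +ˢ const (s * s) ✶ (expRemainder s ✶ (X ✶ (X ✶ b)))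
      ≈⟨ S.+-cong (S.+-congˡ {b} (const-✶ s _)) (const-✶ (s * s) _) ⟩
    b +ˢ s ⋆ (X ✶ b) +ˢ (s * s) ⋆ (expRemainder s ✶ (X ✶ (X ✶ b))) ∎
    where b = shift i (B α x)

-- Binomial coefficients as coefficients of Bernoulli series

module FallingFactorial {c ℓ₁ ℓ₂ ℓ₃} (R : RealNumbers c ℓ₁ ℓ₂ ℓ₃) where
  open RealNumbers R hiding (zero)
  open Analysis R
  open FormalPowerSeries R
  open BernoulliSeries R
  open IntegerSolver commutativeRing
  open SetoidReasoning setoid

  -- The factor α of the recurrence for B^{(α+1)} cancels n exactly on the
  -- diagonal α = n, which kills the term in B_n^{(n)}.
  B-diagonal : ∀ n x → fromℕ (suc n) * B (suc (suc n)) x (suc n) ≈ (x - fromℕ (suc n)) * B (suc n) x n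
  B-diagonal n x = begin
    N * b₂
      ≈⟨ solve 5 (λ N b₁ b₂ b x → N :* b₂ := N :* b₁ :- (N :* (b₁ :- b₂ :- b) :+ x :* b) :+ (x :- N) :* b) refl N b₁ b₂ b x ⟩
    N * b₁ - (N * (b₁ - b₂ - b) + x * b) + (x - N) * b
      ≈⟨ +-congʳ (+-congˡ (-‿cong recurrence)) ⟨
    N * b₁ - N * b₁ + (x - N) * b
      ≈⟨ solve 2 (λ y z → y :- y :+ z := z) refl (N * b₁) _ ⟩
    (x - N) * b ∎
    where
    N  = fromℕ (suc n)
    b  = B (suc n) x n
    b₁ = B (suc n) x (suc n)
    b₂ = B (suc (suc n)) x (suc n)
    recurrence : N * b₁ ≈ N * (b₁ - b₂ - b) + x * b
    recurrence = trans (θ-B (suc n) x (suc n)) (+-cong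
      (trans (const-✶ N _ (suc n)) (*-congˡ (+-congˡ (-‿cong (X✶-suc (B (suc n) x) n)))))
      (trans (const-✶ x _ (suc n)) (*-congˡ (X✶-suc (B (suc n) x) n))))

  product-last : ∀ n (f : ℕ → Carrier) → product {suc n} (λ k → f (toℕ k)) ≈ product {n} (λ k → f (toℕ k)) * f n
  product-last zero    f = *-comm _ _
  product-last (suc n) f = trans (*-congˡ (product-last n (λ k → f (suc k)))) (sym (*-assoc _ _ _))

  -- Induction along the diagonal with `B-diagonal`: at the argument 1 + w each step contributes the
  -- factor (1 + w) - (n + 1) = w - n.
  B≈product : ∀ n w → fromℕ (n !) * B (suc n) (1# + w) n ≈ product {n} (λ k → w - fromℕ (toℕ k))
  B≈product zero    w = begin
    fromℕ 1 * B 1 (1# + w) 0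
      ≈⟨ *-congˡ (✶-zero (r ^ˢ 1) (expˢ (1# + w))) ⟩
    fromℕ 1 * ((r ⊛ oneˢ) 0 * expˢ (1# + w) 0)
      ≈⟨ *-congˡ (*-cong (+-identityʳ _) (exp-zero (1# + w))) ⟩
    (1# + 0#) * (1# * 1# * 1#)
      ≈⟨ solve 0 ((:1 :+ :0) :* (:1 :* :1 :* :1) := :1) refl ⟩
    1# ∎
  B≈product (suc n) w = begin
    fromℕ (suc n !) * B (suc (suc n)) (1# + w) (suc n)
      ≈⟨ *-congʳ (fromℕ-! n) ⟩
    fromℕ (suc n) * fromℕ (n !) * B (suc (suc n)) (1# + w) (suc n)
      ≈⟨ solve 3 (λ a b c → a :* b :* c := b :* (a :* c)) refl (fromℕ (suc n)) (fromℕ (n !)) _ ⟩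
    fromℕ (n !) * (fromℕ (suc n) * B (suc (suc n)) (1# + w) (suc n))
      ≈⟨ *-congˡ (B-diagonal n (1# + w)) ⟩
    fromℕ (n !) * ((1# + w - fromℕ (suc n)) * B (suc n) (1# + w) n)
      ≈⟨ solve 4 (λ f w n b → f :* ((:1 :+ w :- (:1 :+ n)) :* b) := f :* b :* (w :- n)) refl (fromℕ (n !)) w (fromℕ n) _ ⟩
    fromℕ (n !) * B (suc n) (1# + w) n * (w - fromℕ n)
      ≈⟨ *-congʳ (B≈product n w) ⟩
    product {n} (λ k → w - fromℕ (toℕ k)) * (w - fromℕ n)
      ≈⟨ product-last n (λ k → w - fromℕ k) ⟨
    product {suc n} (λ k → w - fromℕ (toℕ k)) ∎

  binomial≈B : ∀ n w → binomial w n ≈ B (suc n) (1# + w) n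
  binomial≈B n w = sym (/!-unique n (B≈product n w))

-- Order, absolute bounds and the Archimedean property

module OrderedField {c ℓ₁ ℓ₂ ℓ₃} (R : RealNumbers c ℓ₁ ℓ₂ ℓ₃) where
  open RealNumbers R hiding (zero)
  open Analysis R
  open FormalPowerSeries R using (inverseʳ; n*[x/n])
  open import Algebra.Apartness.Properties.HeytingCommutativeRing
    heytingCommutativeRing using (x-0≈x; invertibleˡ⇒#)
  open IsStrictPartialOrder <-isStrictPartialOrder public
    using () renaming (trans to <-trans; irrefl to <-irrefl; <-respˡ-≈ to <-respˡ; <-respʳ-≈ to <-respʳ)
  open IntegerSolver commutativeRing
  open SetoidReasoning setoid

  <-resp : ∀ {x y x′ y′} → x ≈ x′ → y ≈ y′ → x < y → x′ < y′
  <-resp x≈x′ y≈y′ x<y = <-respˡ x≈x′ (<-respʳ y≈y′ x<y)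

  +-mono-< : ∀ {x y u v} → x < y → u < v → x + u < y + v
  +-mono-< {x} {y} {u} {v} x<y u<v =
    <-trans (+-monoˡ-< u x<y) (<-resp (+-comm u y) (+-comm v y) (+-monoˡ-< y u<v))

  0<y-x : ∀ {x y} → x < y → 0# < y - x
  0<y-x {x} {y} x<y = <-respˡ (-‿inverseʳ x) (+-monoˡ-< (- x) x<y)

  x<y⇐ : ∀ {x y z} → z ≈ y - x → 0# < z → x < y
  x<y⇐ {x} {y} z≈y-x 0<z = <-resp (+-identityˡ x)
    (trans (+-congʳ z≈y-x) (solve 2 (λ x y → (y :- x) :+ x := y) refl x y)) (+-monoˡ-< x 0<z)

  *-monoˡ-< : ∀ {z x y} → 0# < z → x < y → z * x < z * y
  *-monoˡ-< {z} {x} {y} 0<z x<y = x<y⇐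
    (solve 3 (λ x y z → z :* (y :- x) := z :* y :- z :* x) refl x y z) (*-pos 0<z (0<y-x x<y))

  x<y+x : ∀ {x y} → 0# < y → x < y + x
  x<y+x {x} 0<y = <-respˡ (+-identityˡ x) (+-monoˡ-< x 0<y)

  pos⇒# : ∀ {x} → 0# < x → x # 0#
  pos⇒# 0<x = #-sym (<⇒# 0<x)

  -- An inverse is itself invertible, hence apart from 0, so its sign can be decided; a negative
  -- sign would give 1 < 0.
  inverse-pos : ∀ {x} (0<x : 0# < x) (x#0 : x # 0#) → 0# < inverse x x#0
  inverse-pos {x} 0<x x#0 with #⇒<⊎> (invertibleˡ⇒# (x , trans (*-congˡ (x-0≈x _)) (inverseʳ x x#0)))
  ... | inj₂ 0<x⁻¹ = 0<x⁻¹
  ... | inj₁ x⁻¹<0 = ⊥-elim (<-irrefl refl (<-trans 0<1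
    (<-resp (inverseʳ x x#0) (zeroʳ x) (*-monoˡ-< 0<x x⁻¹<0))))

  half : Carrier → Carrier
  half x = x / 2

  half+half : ∀ x → half x + half x ≈ x
  half+half x = trans (solve 1 (λ h → h :+ h := (:1 :+ (:1 :+ :0)) :* h) refl (half x)) (n*[x/n] x 2)

  /-pos : ∀ {x} n .{{_ : NonZero n}} → 0# < x → 0# < x / n
  /-pos n@(suc m) 0<x = *-pos 0<x (inverse-pos (0<fromℕ[1+n] m) (fromℕ#0 n))

  x+x-pos : ∀ {x} → 0# < x + x → 0# < x
  x+x-pos {x} 0<x+x = <-respʳ
    (trans (solve 2 (λ x i → (x :+ x) :* i := x :* i :+ x :* i) refl x _) (half+half x))
    (/-pos 2 0<x+x)

  ∣∣<-resp : ∀ {x y a b} → x ≈ y → a ≈ b → ∣ x ∣< a → ∣ y ∣< b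
  ∣∣<-resp x≈y a≈b (-a<x , x<a) = <-resp (-‿cong a≈b) x≈y -a<x , <-resp x≈y a≈b x<a

  ∣∣<-respˡ : ∀ {x y a} → x ≈ y → ∣ x ∣< a → ∣ y ∣< a
  ∣∣<-respˡ x≈y = ∣∣<-resp x≈y refl

  ∣∣<-neg : ∀ {x a} → ∣ x ∣< a → ∣ - x ∣< a
  ∣∣<-neg {x} {a} (-a<x , x<a) =
    x<y⇐ (solve 2 (λ x a → a :- x := :- x :- :- a) refl x a) (0<y-x x<a) ,
    x<y⇐ (solve 2 (λ x a → x :- :- a := a :- :- x) refl x a) (0<y-x -a<x)

  ∣∣<-weaken : ∀ {x a b} → a < b → ∣ x ∣< a → ∣ x ∣< b
  ∣∣<-weaken {x} {a} {b} a<b (-a<x , x<a) =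
    <-trans (x<y⇐ (solve 2 (λ a b → b :- a := :- a :- :- b) refl a b) (0<y-x a<b)) -a<x , <-trans x<a a<b

  ∣∣<-+ : ∀ {x y a b} → ∣ x ∣< a → ∣ y ∣< b → ∣ x + y ∣< (a + b)
  ∣∣<-+ {x} {y} {a} {b} (-a<x , x<a) (-b<y , y<b) =
    <-respˡ (solve 2 (λ a b → :- a :+ :- b := :- (a :+ b)) refl a b) (+-mono-< -a<x -b<y) , +-mono-< x<a y<b

  -- From -a < x < a it follows that 0 < a + a.
  ∣∣<⇒pos : ∀ {x a} → ∣ x ∣< a → 0# < a
  ∣∣<⇒pos {x} {a} (-a<x , x<a) = x+x-pos (<-respʳ
    (solve 1 (λ a → a :- :- a := a :+ a) refl a) (0<y-x (<-trans -a<x x<a)))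

  -- Twice `a * b - x * y` equals (a - x)(y + b) + (x + a)(b - y), a sum of products of positive
  -- factors. No case distinction on the signs of `x` and `y` is made, since these are not decidable
  -- constructively.
  x<a⇒x*y<ab : ∀ {x y a b} → ∣ x ∣< a → ∣ y ∣< b → x * y < a * b
  x<a⇒x*y<ab {x} {y} {a} {b} (-a<x , x<a) (-b<y , y<b) = x<y⇐ refl (x+x-pos (<-respʳ
    (solve 4 (λ x y a b → (a :- x) :* (y :- :- b) :+ (x :- :- a) :* (b :- y)
                       := (a :* b :- x :* y) :+ (a :* b :- x :* y)) refl x y a b)
    (<-respˡ (+-identityˡ 0#) (+-mono-< (*-pos (0<y-x x<a) (0<y-x -b<y)) (*-pos (0<y-x -a<x) (0<y-x y<b))))))

  ∣∣<-* : ∀ {x y a b} → ∣ x ∣< a → ∣ y ∣< b → ∣ x * y ∣< (a * b)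
  ∣∣<-* {x} {y} {a} {b} ∣x∣<a ∣y∣<b =
    x<y⇐ (solve 4 (λ x y a b → a :* b :- (:- x) :* y := x :* y :- :- (a :* b)) refl x y a b)
         (0<y-x (x<a⇒x*y<ab (∣∣<-neg ∣x∣<a) ∣y∣<b)) ,
    x<a⇒x*y<ab ∣x∣<a ∣y∣<b

  ∣0∣< : ∀ {a} → 0# < a → ∣ 0# ∣< a
  ∣0∣< {a} 0<a = x<y⇐ (solve 1 (λ a → a := :0 :- :- a) refl a) 0<a , 0<a

  magnitude : ∀ x → ∃[ a ] ∣ x ∣< a
  magnitude x with archimedean x | archimedean (- x)
  -- The successors make both summands positive even if `m` or `n` is 0, so their sum strictly
  -- exceeds both x and -x.
  ... | m , x<m | n , -x<n = fromℕ (suc m) + fromℕ (suc n) ,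
    x<y⇐ (solve 3 (λ x M N → M :+ N :- :- x := x :- :- (M :+ N)) refl x _ _)
         (0<y-x (<-trans (<-trans -x<n (x<y+x 0<1)) (x<y+x (0<fromℕ[1+n] m)))) ,
    <-respʳ (+-comm _ _) (<-trans (<-trans x<m (x<y+x 0<1)) (x<y+x (0<fromℕ[1+n] n)))

  -- Equality follows by tightness: if x and y were apart, their distance would be an ε that
  -- violates the assumption.
  ∣∣<ε⇒≈ : ∀ {x y} → (∀ ε → 0# < ε → ∣ x - y ∣< ε) → x ≈ y
  ∣∣<ε⇒≈ {x} {y} close = proj₁ (tight x y) λ x#y → apart (#⇒<⊎> x#y)
    where
    apart : x < y ⊎ y < x → ⊥
    apart (inj₁ x<y) = <-irrefl (solve 2 (λ x y → :- (y :- x) := x :- y) refl x y)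
                                (proj₁ (close (y - x) (0<y-x x<y)))
    apart (inj₂ y<x) = <-irrefl refl (proj₂ (close (x - y) (0<y-x y<x)))

  -- Stated for at least one summand, since the strict bound fails for the empty sum.
  ∣sum∣< : ∀ n {a} (v : Fin (suc n) → Carrier) → (∀ k → ∣ v k ∣< a) → ∣ sum v ∣< (fromℕ (suc n) * a)
  ∣sum∣< zero    {a} v bound = ∣∣<-resp (sym (+-identityʳ _))
    (solve 1 (λ a → a := (:1 :+ :0) :* a) refl a) (bound Fin.zero)
  ∣sum∣< (suc n) {a} v bound = ∣∣<-resp refl
    (solve 2 (λ n a → a :+ n :* a := (:1 :+ n) :* a) refl (fromℕ (suc n)) a)
    (∣∣<-+ (bound Fin.zero) (∣sum∣< n (λ k → v (Fin.suc k)) (λ k → bound (Fin.suc k))))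

  -- Step length of a subdivision of the unit interval into n + 2 pieces; with at least two pieces,
  -- `w` is strictly below 1.
  Mesh : ℕ → Carrier → Set _
  Mesh n w = 0# < w × fromℕ (suc (suc n)) * w ≈ 1#

  fine-mesh : ∀ {M ε δ} → 0# < M → 0# < ε → 0# < δ →
              ∃[ n ] ∃[ w ] Mesh n w × w * M < ε × w < δ
  -- A natural number above M/ε + 1/δ is above both summands, so a single `n` serves both
  -- requirements on w = 1/(n + 2).
  fine-mesh {M} {ε} {δ} 0<M 0<ε 0<δ with archimedean (M * inverse ε (pos⇒# 0<ε) + 1# * inverse δ (pos⇒# 0<δ))
  ... | n , above = n , w , (0<w , n*[x/n] 1# (suc (suc n))) ,
    below 0<ε (<-trans (<-respʳ (+-comm _ _) (x<y+x (*-pos 0<1 (inverse-pos 0<δ _)))) above) ,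
    <-respˡ (*-identityʳ _) (below 0<δ (<-trans (x<y+x (*-pos 0<M (inverse-pos 0<ε _))) above))
    where
    w = 1# / suc (suc n)
    0<w : 0# < w
    0<w = /-pos (suc (suc n)) 0<1
    below : ∀ {a b} (0<b : 0# < b) → a * inverse b (pos⇒# 0<b) < fromℕ n → w * a < b
    below {a} {b} 0<b a/b<n = <-resp
      (begin
        b * w * (a * b⁻¹)   ≈⟨ solve 4 (λ a b c w → b :* w :* (a :* c) := w :* a :* (b :* c)) refl a b b⁻¹ w ⟩
        w * a * (b * b⁻¹)   ≈⟨ *-congˡ (inverseʳ b _) ⟩
        w * a * 1#          ≈⟨ *-identityʳ _ ⟩
        w * a               ∎)
      (begin
        b * w * fromℕ (suc (suc n))   ≈⟨ solve 3 (λ b w n → b :* w :* n := b :* (n :* w)) refl b w (fromℕ (suc (suc n))) ⟩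
        b * (fromℕ (suc (suc n)) * w) ≈⟨ *-congˡ (n*[x/n] 1# (suc (suc n))) ⟩
        b * 1#                        ≈⟨ *-identityʳ b ⟩
        b                             ∎)
      (*-monoˡ-< (*-pos 0<b 0<w) (<-trans a/b<n (<-trans (x<y+x 0<1) (x<y+x 0<1))))
      where b⁻¹ = inverse b (pos⇒# 0<b)

-- Uniform bounds for series depending on a parameter

module Boundedness {c ℓ₁ ℓ₂ ℓ₃} (R : RealNumbers c ℓ₁ ℓ₂ ℓ₃) where
  open RealNumbers R hiding (zero)
  open Analysis R
  open FormalPowerSeries R
  open BernoulliSeries R
  open OrderedField R

  module _ {a} {A : Set a} where

    -- The index type is arbitrary because remainders are bounded both over steps `h` and over pairs
    -- `(t , h)`, with entries of absolute value below 1.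
    Bounded : (A → Carrier) → Set (a ⊔ c ⊔ ℓ₃)
    Bounded f = ∃[ M ] (∀ x → ∣ f x ∣< M)

    Boundedˢ : (A → Series) → Set (a ⊔ c ⊔ ℓ₃)
    Boundedˢ f = ∀ n → Bounded (λ x → f x n)

    const-bounded : ∀ y → Bounded (λ _ → y)
    const-bounded y with magnitude y
    ... | M , ∣y∣<M = M , λ _ → ∣y∣<M

    +-bounded : ∀ {f g} → Bounded f → Bounded g → Bounded (λ x → f x + g x)
    +-bounded (M , f<M) (N , g<N) = M + N , λ x → ∣∣<-+ (f<M x) (g<N x)

    *-bounded : ∀ {f g} → Bounded f → Bounded g → Bounded (λ x → f x * g x)
    *-bounded (M , f<M) (N , g<N) = M * N , λ x → ∣∣<-* (f<M x) (g<N x)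

    ^-bounded : ∀ {f} → Bounded f → ∀ n → Bounded (λ x → f x ^ n)
    ^-bounded f-bounded zero    = const-bounded 1#
    ^-bounded f-bounded (suc n) = *-bounded f-bounded (^-bounded f-bounded n)

    sum-bounded : ∀ {n} {f : Fin n → A → Carrier} → (∀ k → Bounded (f k)) → Bounded (λ x → sum (λ k → f k x))
    sum-bounded {zero}  f-bounded = const-bounded 0#
    sum-bounded {suc n} f-bounded = +-bounded (f-bounded Fin.zero) (sum-bounded (λ k → f-bounded (Fin.suc k)))

    ✶-bounded : ∀ {f g} → Boundedˢ f → Boundedˢ g → Boundedˢ (λ x → f x ✶ g x)
    ✶-bounded {f} {g} f-bounded g-bounded n =
      let M , bound = sum-bounded {suc n} λ k → *-bounded (f-bounded (toℕ k)) (g-bounded (n ∸ toℕ k))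
      in M , λ x → ∣∣<-respˡ (sym (✶≋⊛ (f x) (g x) n)) (bound x)

    shift-bounded : ∀ i {f} → Boundedˢ f → Boundedˢ (λ x → shift i (f x))
    shift-bounded zero    f-bounded = f-bounded
    shift-bounded (suc i) f-bounded = ✶-bounded (λ n → const-bounded (X n)) (shift-bounded i f-bounded)

    expRemainder-bounded : ∀ {f} → Bounded f → Boundedˢ (λ x → expRemainder (f x))
    expRemainder-bounded f-bounded n = *-bounded (^-bounded f-bounded n) (const-bounded _)

    B-bounded : ∀ α {f} → Bounded f → Boundedˢ (λ x → B α (f x))
    B-bounded α f-bounded = ✶-bounded (λ n → const-bounded ((r ^ˢ α) n))
      (λ n → *-bounded (^-bounded f-bounded n) (const-bounded _))

-- Derivatives and integrals from Taylor expansions with bounded remainder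

module Calculus {c ℓ₁ ℓ₂ ℓ₃} (R : RealNumbers c ℓ₁ ℓ₂ ℓ₃) where
  open RealNumbers R hiding (zero)
  open Analysis R
  open FormalPowerSeries R using (inverseʳ)
  open OrderedField R
  open Boundedness R
  open IntegerSolver commutativeRing
  open SetoidReasoning setoid
  open Sum semiring using (∑-distrib-+; sum-cong-≋)

  Unit : Set _
  Unit = ∃[ h ] ∣ h ∣< 1#

  HasDerivativeAt-resp : ∀ {f d e x} → d ≈ e → HasDerivativeAt f d x → HasDerivativeAt f e x
  HasDerivativeAt-resp d≈e derivative ε 0<ε with derivative ε 0<ε
  ... | δ , 0<δ , close = δ , 0<δ , λ h h#0 ∣h∣<δ →
    ∣∣<-respˡ (+-congˡ (-‿cong d≈e)) (close h h#0 ∣h∣<δ)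

  taylor⇒derivative : ∀ {f d x} (q : Carrier → Carrier) →
    Bounded {A = Unit} (λ (h , _) → q h) →
    (∀ h → f (x + h) ≈ f x + h * d + h * h * q h) →
    HasDerivativeAt f d x
  taylor⇒derivative {f} {d} {x} q (M , q<M) taylor ε 0<ε =
    w , proj₁ mesh , λ h h#0 ∣h∣<w → ∣∣<-respˡ (sym (quotient h h#0)) (∣∣<-weaken (proj₁ fineness) (∣∣<-* ∣h∣<w (q<M (h , ∣∣<-weaken (proj₂ fineness) ∣h∣<w))))
    where
    -- Here `fine-mesh` only supplies the radius `w`: `w * M < ε` controls the error `h * q h`, and
    -- `w < 1` puts `h` into the range where `q` is bounded. The bound `M` is positive because it
    -- bounds the value of `q` at 0.
    chosen = fine-mesh (∣∣<⇒pos (q<M (0# , ∣0∣< 0<1))) 0<ε 0<1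
    w = proj₁ (proj₂ chosen)
    mesh = proj₁ (proj₂ (proj₂ chosen))
    fineness = proj₂ (proj₂ (proj₂ chosen))
    quotient : ∀ h (h#0 : h # 0#) → (f (x + h) - f x) * inverse h h#0 - d ≈ h * q h
    quotient h h#0 = begin
      (f (x + h) - f x) * h⁻¹ - d
        ≈⟨ +-congʳ (*-congʳ (+-congʳ (taylor h))) ⟩
      (f x + h * d + h * h * q h - f x) * h⁻¹ - d
        ≈⟨ solve 5 (λ f d h q i → (f :+ h :* d :+ h :* h :* q :- f) :* i :- d := h :* i :* (d :+ h :* q) :- d) refl (f x) d h (q h) h⁻¹ ⟩
      h * h⁻¹ * (d + h * q h) - d
        ≈⟨ +-congʳ (*-congʳ (inverseʳ h h#0)) ⟩
      1# * (d + h * q h) - d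
        ≈⟨ solve 2 (λ d y → :1 :* (d :+ y) :- d := y) refl d (h * q h) ⟩
      h * q h ∎
      where h⁻¹ = inverse h h#0

  module UniformPartition (n : ℕ) (w : Carrier) (mesh : Mesh n w) where
    N : ℕ
    N = suc (suc n)

    0<w : 0# < w
    0<w = proj₁ mesh

    N*w≈1 : fromℕ N * w ≈ 1#
    N*w≈1 = proj₂ mesh

    node : ℕ → Carrier
    node k = fromℕ k * w

    node-suc : ∀ k → node (suc k) ≈ node k + w
    node-suc k = solve 2 (λ k w → (:1 :+ k) :* w := k :* w :+ w) refl (fromℕ k) w

    node-inject₁ : ∀ {m} (k : Fin m) → node (toℕ (inject₁ k)) ≡ node (toℕ k)
    node-inject₁ k = ≡.cong node (toℕ-inject₁ k)

    node-end : node (toℕ (Fin.fromℕ N)) ≈ 1#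
    node-end = trans (reflexive (≡.cong node (toℕ-fromℕ N))) (N*w≈1)

    partition : TaggedPartition 0# 1#
    partition = record
      { size      = N
      ; point     = λ k → node (toℕ k)
      -- Tags are left endpoints, the points at which the Taylor expansion is taken.
      ; tag       = λ k → node (toℕ k)
      ; start     = zeroˡ w
      ; end       = node-end
      ; point≤tag = λ k → <-irrefl (reflexive (≡.sym (node-inject₁ k)))
      ; tag≤point = λ k k+1<k → <-irrefl refl (<-trans k+1<k
          (<-respʳ (trans (+-comm _ _) (sym (node-suc (toℕ k)))) (x<y+x 0<w)))
      }

    open TaggedPartition partition using (width; riemannSum) public

    width≈w : ∀ k → width k ≈ w
    width≈w k = begin
      node (suc (toℕ k)) - node (toℕ (inject₁ k)) ≈⟨ +-cong (node-suc (toℕ k)) (-‿cong (reflexive (node-inject₁ k))) ⟩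
      node (toℕ k) + w - node (toℕ k)             ≈⟨ solve 2 (λ t w → t :+ w :- t := w) refl (node (toℕ k)) w ⟩
      w                                           ∎

    fromℕ-mono-< : ∀ {k m} → k ℕ.< m → fromℕ k < fromℕ m
    fromℕ-mono-< {zero}  {suc m} _           = 0<fromℕ[1+n] m
    fromℕ-mono-< {suc k} {suc m} (ℕ.s≤s k<m) = <-resp (+-comm _ _) (+-comm _ _) (+-monoˡ-< 1# (fromℕ-mono-< k<m))

    -- Only the last node reaches 1, and it is not a tag; so every tag lies in `Unit`.
    ∣node∣<1 : ∀ {k} → k ℕ.< N → ∣ node k ∣< 1#
    ∣node∣<1 {k} k<N =
      <-resp (trans (solve 2 (λ w N → w :* (:- N) := :- (N :* w)) refl w (fromℕ N)) (-‿cong (N*w≈1))) (*-comm w _)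
             (*-monoˡ-< 0<w (x<y⇐ (solve 2 (λ k n → :1 :+ k :+ (:1 :+ n) := k :- :- (:1 :+ (:1 :+ n))) refl (fromℕ k) (fromℕ n))
               (<-respˡ (+-identityˡ 0#) (+-mono-< (0<fromℕ[1+n] k) (0<fromℕ[1+n] n))))) ,
      <-resp (*-comm w _) (trans (*-comm w _) (N*w≈1)) (*-monoˡ-< 0<w (fromℕ-mono-< k<N))

    ∣w∣<1 : ∣ w ∣< 1#
    ∣w∣<1 = ∣∣<-respˡ (solve 1 (λ w → (:1 :+ :0) :* w := w) refl w) (∣node∣<1 {1} (ℕ.s≤s (ℕ.s≤s ℕ.z≤n)))

  sum-telescope : ∀ n (g : ℕ → Carrier) → sum {n} (λ k → g (suc (toℕ k)) - g (toℕ k)) ≈ g n - g 0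
  sum-telescope zero    g = sym (-‿inverseʳ (g 0))
  sum-telescope (suc n) g = trans (+-congˡ (sum-telescope n (λ k → g (suc k))))
    (solve 3 (λ x y z → (y :- x) :+ (z :- y) := z :- x) refl (g 0) (g 1) (g (suc n)))

  -- On each piece the increment of `F` differs from the Riemann term by w² q. The increments
  -- telescope, and N errors below w² M add up to less than w M because N w = 1. So fine Riemann
  -- sums are close to both `I` and `F 1# - F 0#`.
  taylor⇒integral : ∀ {f I} (F : Carrier → Carrier) (q : Carrier → Carrier → Carrier) →
    (∀ {x y} → x ≈ y → F x ≈ F y) →
    Bounded {A = Unit × Unit} (λ ((t , _) , (h , _)) → q t h) →
    (∀ t h → F (t + h) ≈ F t + h * f t + h * h * q t h) →
    IsIntegral 0# 1# f I → I ≈ F 1# - F 0#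
  taylor⇒integral {f} {I} F q F-cong (M , q<M) taylor integral = ∣∣<ε⇒≈ close
    where
    0<M : 0# < M
    0<M = ∣∣<⇒pos (q<M ((0# , ∣0∣< 0<1) , (0# , ∣0∣< 0<1)))

    module _ (n : ℕ) (w : Carrier) (mesh : Mesh n w) where
      open UniformPartition n w mesh

      error : Fin N → Carrier
      error k = (F (node (suc (toℕ k))) - F (node (toℕ k))) - f (node (toℕ k)) * width k

      error≈ : ∀ k → error k ≈ w * w * q (node (toℕ k)) w
      error≈ k = begin
        (F (node (suc (toℕ k))) - F t) - f t * width k
          ≈⟨ +-cong (+-congʳ (trans (F-cong (node-suc (toℕ k))) (taylor t w))) (-‿cong (*-congˡ (width≈w k))) ⟩
        (F t + w * f t + w * w * q t w - F t) - f t * w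
          ≈⟨ solve 4 (λ F f w q → (F :+ w :* f :+ w :* w :* q :- F) :- f :* w := w :* w :* q) refl (F t) (f t) w (q t w) ⟩
        w * w * q t w ∎
        where t = node (toℕ k)

      sum-error : sum error + riemannSum f ≈ F 1# - F 0#
      sum-error = begin
        sum error + riemannSum f
          ≈⟨ ∑-distrib-+ {N} error (λ k → f (node (toℕ k)) * width k) ⟨
        sum (λ k → error k + f (node (toℕ k)) * width k)
          ≈⟨ sum-cong-≋ {N} (λ k → solve 2 (λ a b → a :- b :+ b := a) refl (F (node (suc (toℕ k))) - F (node (toℕ k))) (f (node (toℕ k)) * width k)) ⟩
        sum {N} (λ k → F (node (suc (toℕ k))) - F (node (toℕ k)))
          ≈⟨ sum-telescope N (λ k → F (node k)) ⟩
        F (node N) - F (node 0)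
          ≈⟨ +-cong (F-cong (N*w≈1)) (-‿cong (F-cong (zeroˡ w))) ⟩
        F 1# - F 0# ∎

      ∣sum-error∣< : ∣ sum error ∣< (w * M)
      ∣sum-error∣< = ∣∣<-resp refl
        (begin
          fromℕ N * (w * (w * M)) ≈⟨ solve 3 (λ N w M → N :* (w :* (w :* M)) := N :* w :* (w :* M)) refl (fromℕ N) w M ⟩
          fromℕ N * w * (w * M)   ≈⟨ *-congʳ (N*w≈1) ⟩
          1# * (w * M)            ≈⟨ *-identityˡ _ ⟩
          w * M                   ∎)
        (∣sum∣< (suc n) error λ k → ∣∣<-respˡ (trans (sym (*-assoc w w _)) (sym (error≈ k)))
          (w*-bound (w*-bound (q<M ((node (toℕ k) , ∣node∣<1 (toℕ<n k)) , (w , ∣w∣<1))))))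
        where
        -- Scaling by the positive `w` keeps the exact factor `w`, whereas `∣∣<-*` would require the
        -- false strict bound `∣ w ∣< w`.
        w*-bound : ∀ {x a} → ∣ x ∣< a → ∣ w * x ∣< (w * a)
        w*-bound {x} {a} (-a<x , x<a) =
          <-respˡ (solve 2 (λ w a → w :* (:- a) := :- (w :* a)) refl w a) (*-monoˡ-< 0<w -a<x) , *-monoˡ-< 0<w x<a

    close : ∀ ε → 0# < ε → ∣ I - (F 1# - F 0#) ∣< ε
    -- Half of ε is spent on the distance from the Riemann sum to `I`, the other half on the
    -- accumulated Taylor error.
    close ε 0<ε = ∣∣<-resp
      (begin
        - (S - I) + - e            ≈⟨ solve 3 (λ S I e → :- (S :- I) :+ :- e := I :- (e :+ S)) refl S I e ⟩
        I - (e + S)                ≈⟨ +-congˡ (-‿cong (sum-error n w mesh)) ⟩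
        I - (F 1# - F 0#)          ∎)
      (half+half ε)
      (∣∣<-+ (∣∣<-neg (near partition (λ k → <-respˡ (sym (width≈w k)) w<δ)))
             (∣∣<-neg (∣∣<-weaken wM<ε/2 (∣sum-error∣< n w mesh))))
      where
      ε/2-fine = integral (half ε) (/-pos 2 0<ε)
      near = proj₂ (proj₂ ε/2-fine)
      chosen = fine-mesh 0<M (/-pos 2 0<ε) (proj₁ (proj₂ ε/2-fine))
      n = proj₁ chosen
      w = proj₁ (proj₂ chosen)
      mesh = proj₁ (proj₂ (proj₂ chosen))
      wM<ε/2 = proj₁ (proj₂ (proj₂ (proj₂ chosen)))
      w<δ = proj₂ (proj₂ (proj₂ (proj₂ chosen)))
      open UniformPartition n w mesh
      S = riemannSum f
      e = sum (error n w mesh)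

-- Closed forms, derivatives and expansions of the Cauchy polynomials

module CauchyPolynomials {c ℓ₁ ℓ₂ ℓ₃} (R : RealNumbers c ℓ₁ ℓ₂ ℓ₃) where
  open RealNumbers R hiding (zero)
  open Analysis R
  open FormalPowerSeries R
  open BernoulliSeries R
  open FallingFactorial R
  open Boundedness R
  open Calculus R
  open IntegerSolver commutativeRing
  open SetoidReasoning setoid
  open Sum semiring using (sum-cong-≋; *-distribˡ-sum)

  IsIteratedDerivative-resp : ∀ {i f g h} → (∀ x → g x ≈ h x) →
    IsIteratedDerivative i f g → IsIteratedDerivative i f h
  IsIteratedDerivative-resp g≈h (base f≈g)          = base λ x → trans (f≈g x) (g≈h x)
  IsIteratedDerivative-resp g≈h (step {g = f′} iterated der) =
    step iterated λ x → HasDerivativeAt-resp {f′} (g≈h x) (der x)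

  iterate : ∀ {f} (g : ℕ → Carrier → Carrier) → (∀ x → f x ≈ g 0 x) →
    (∀ i x → HasDerivativeAt (g i) (g (suc i) x) x) → ∀ i → IsIteratedDerivative i f (g i)
  iterate g f≈g₀ der zero    = base f≈g₀
  iterate g f≈g₀ der (suc i) = step (iterate g f≈g₀ der i) (der i)

  module _ (n : ℕ) (y σ : Carrier) where

    -- The candidate for the i-th derivative of n! [t^n] B n (y + σx): each differentiation produces
    -- a factor σ and a factor t. The pair (y, σ) is (1, -1) for the first kind and (0, 1) for the
    -- second.
    derivative : ℕ → Carrier → Carrier
    derivative i x = fromℕ (n !) * σ ^ i * shift i (B n (y + σ * x)) n

    derivative-suc : ∀ i x → HasDerivativeAt (derivative i) (derivative (suc i) x) x
    derivative-suc i x = taylor⇒derivative {derivative i} (λ h → K * (σ * σ) * q h)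
      (*-bounded (const-bounded (K * (σ * σ)))
        (✶-bounded (expRemainder-bounded (*-bounded (const-bounded σ) (1# , proj₂)))
                   (λ m → const-bounded (shift (suc (suc i)) (B n z) m)) n))
      λ h → begin
        K * shift i (B n (y + σ * (x + h))) n
          ≈⟨ *-congˡ (shift-cong i (B-cong n (solve 4 (λ y σ x h → y :+ σ :* (x :+ h) := y :+ σ :* x :+ σ :* h) refl y σ x h)) n) ⟩
        K * shift i (B n (z + σ * h)) n
          ≈⟨ *-congˡ (shift-B-taylor i n z (σ * h) n) ⟩
        K * (shift i (B n z) n + σ * h * shift (suc i) (B n z) n + σ * h * (σ * h) * q h)
          ≈⟨ solve 7 (λ n! p σ h b b′ q → n! :* p :* (b :+ σ :* h :* b′ :+ σ :* h :* (σ :* h) :* q) :=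
               n! :* p :* b :+ h :* (n! :* (σ :* p) :* b′) :+ h :* h :* (n! :* p :* (σ :* σ) :* q))
             refl (fromℕ (n !)) (σ ^ i) σ h (shift i (B n z) n) (shift (suc i) (B n z) n) (q h) ⟩
        derivative i x + h * derivative (suc i) x + h * h * (K * (σ * σ) * q h) ∎
      where
      K = fromℕ (n !) * σ ^ i
      z = y + σ * x
      q : Carrier → Carrier
      q h = (expRemainder (σ * h) ✶ shift (suc (suc i)) (B n z)) n

    module _ (σσ≈1 : σ * σ ≈ 1#) {f : Carrier → Carrier}
             (f≈B : ∀ t → f t ≈ B (suc n) (y + σ * t) n) where

      -- Differentiation produces σ² = 1 and a factor t, which lowers the coefficient index from
      -- `suc n` to `n` and returns `f`. The prefactor σ plays the part of 1/σ.
      primitive′ : Carrier → Carrier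
      primitive′ t = σ * B (suc n) (y + σ * t) (suc n)

      integral-B : ∀ {I} → IsIntegral 0# 1# f I → I ≈ primitive′ 1# - primitive′ 0#
      integral-B = taylor⇒integral primitive′ (λ t h → σ * q t h)
        (λ t≈u → *-congˡ (B-cong (suc n) (+-congˡ (*-congˡ t≈u)) (suc n)))
        (*-bounded (const-bounded σ)
          (✶-bounded
            (expRemainder-bounded (*-bounded (const-bounded σ) (1# , λ (_ , (_ , ∣h∣<1)) → ∣h∣<1)))
            (shift-bounded 2 (B-bounded (suc n) (+-bounded (const-bounded y) (*-bounded (const-bounded σ) (1# , λ ((_ , ∣t∣<1) , _) → ∣t∣<1)))))
            (suc n)))
        λ t h → begin
          σ * B (suc n) (y + σ * (t + h)) (suc n)
            ≈⟨ *-congˡ (B-cong (suc n) (solve 4 (λ y σ x h → y :+ σ :* (x :+ h) := y :+ σ :* x :+ σ :* h) refl y σ t h) (suc n)) ⟩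
          σ * B (suc n) (y + σ * t + σ * h) (suc n)
            ≈⟨ *-congˡ (shift-B-taylor 0 (suc n) (y + σ * t) (σ * h) (suc n)) ⟩
          σ * (B (suc n) (y + σ * t) (suc n) + σ * h * (X ✶ B (suc n) (y + σ * t)) (suc n) + σ * h * (σ * h) * q t h)
            ≈⟨ solve 5 (λ σ h b b′ q → σ :* (b :+ σ :* h :* b′ :+ σ :* h :* (σ :* h) :* q) :=
                 σ :* b :+ σ :* σ :* (h :* b′ :+ h :* h :* (σ :* q)))
               refl σ h (B (suc n) (y + σ * t) (suc n)) ((X ✶ B (suc n) (y + σ * t)) (suc n)) (q t h) ⟩
          primitive′ t + σ * σ * (h * (X ✶ B (suc n) (y + σ * t)) (suc n) + h * h * (σ * q t h))
            ≈⟨ +-congˡ (trans (*-congʳ σσ≈1) (*-identityˡ _)) ⟩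
          primitive′ t + (h * (X ✶ B (suc n) (y + σ * t)) (suc n) + h * h * (σ * q t h))
            ≈⟨ +-assoc _ _ _ ⟨
          primitive′ t + h * (X ✶ B (suc n) (y + σ * t)) (suc n) + h * h * (σ * q t h)
            ≈⟨ +-congʳ (+-congˡ (*-congˡ (trans (X✶-suc (B (suc n) (y + σ * t)) n) (sym (f≈B t))))) ⟩
          primitive′ t + h * f t + h * h * (σ * q t h) ∎
        where
        q : Carrier → Carrier → Carrier
        q t h = (expRemainder (σ * h) ✶ shift 2 (B (suc n) (y + σ * t))) (suc n)

  B-difference-suc : ∀ n x → B (suc n) (x + 1#) (suc n) - B (suc n) x (suc n) ≈ B n x n
  B-difference-suc n x = trans (B-difference n x (suc n)) (X✶-suc (B n x) n)

  integral₁ : ∀ {n x I} → IsIntegral 0# 1# (λ t → binomial (t - x) n) I → I ≈ B n (1# - x) n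
  integral₁ {n} {x} {I} integral = begin
    I
      ≈⟨ integral-B n (1# - x) 1# (*-identityˡ 1#) binomial≈ integral ⟩
    1# * B (suc n) (1# - x + 1# * 1#) (suc n) - 1# * B (suc n) (1# - x + 1# * 0#) (suc n)
      ≈⟨ +-cong (trans (*-identityˡ _) (B-cong (suc n) (+-congˡ (*-identityˡ 1#)) (suc n)))
                (-‿cong (trans (*-identityˡ _) (B-cong (suc n) (trans (+-congˡ (zeroʳ 1#)) (+-identityʳ _)) (suc n)))) ⟩
    B (suc n) (1# - x + 1#) (suc n) - B (suc n) (1# - x) (suc n)
      ≈⟨ B-difference-suc n (1# - x) ⟩
    B n (1# - x) n ∎
    where
    binomial≈ : ∀ t → binomial (t - x) n ≈ B (suc n) (1# - x + 1# * t) n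
    binomial≈ t = trans (binomial≈B n (t - x))
      (B-cong (suc n) (solve 2 (λ t x → :1 :+ (t :- x) := :1 :- x :+ :1 :* t) refl t x) n)

  integral₂ : ∀ {n x I} → IsIntegral 0# 1# (λ t → binomial (x - t) n) I → I ≈ B n x n
  integral₂ {n} {x} {I} integral = begin
    I
      -- Since 1 + (x - t) = (x + 1) - t, the slope is -1; it exchanges the end values x and x + 1,
      -- and the prefactor -1 restores the order of the difference.
      ≈⟨ integral-B n (x + 1#) (- 1#) (solve 0 (:- :1 :* :- :1 := :1) refl) binomial≈ integral ⟩
    - 1# * B (suc n) (x + 1# + - 1# * 1#) (suc n) - - 1# * B (suc n) (x + 1# + - 1# * 0#) (suc n)
      ≈⟨ solve 2 (λ b b′ → :- :1 :* b :- :- :1 :* b′ := b′ :- b) refl _ _ ⟩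
    B (suc n) (x + 1# + - 1# * 0#) (suc n) - B (suc n) (x + 1# + - 1# * 1#) (suc n)
      ≈⟨ +-cong (B-cong (suc n) (solve 1 (λ x → x :+ :1 :+ :- :1 :* :0 := x :+ :1) refl x) (suc n))
                (-‿cong (B-cong (suc n) (solve 1 (λ x → x :+ :1 :+ :- :1 :* :1 := x) refl x) (suc n))) ⟩
    B (suc n) (x + 1#) (suc n) - B (suc n) x (suc n)
      ≈⟨ B-difference-suc n x ⟩
    B n x n ∎
    where
    binomial≈ : ∀ t → binomial (x - t) n ≈ B (suc n) (x + 1# + - 1# * t) n
    binomial≈ t = trans (binomial≈B n (x - t))
      (B-cong (suc n) (solve 2 (λ t x → :1 :+ (x :- t) := x :+ :1 :+ :- :1 :* t) refl t x) n)

  -- The sums over m as coefficients of products of series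

  nCk*[k!*[n∸k]!] : ∀ {n k} → k ℕ.≤ n → (n C k) ℕ.* (k ! ℕ.* (n ∸ k) !) ≡ n !
  nCk*[k!*[n∸k]!] {n} {k} k≤n = ≡.trans
    (≡.cong (ℕ._* (k ! ℕ.* (n ∸ k) !)) (nCk≡n!/k![n-k]! k≤n))
    (m/n*n≡m {{k ℕₚ.!* (n ∸ k) !≢0}} (k![n∸k]!∣n! k≤n))

  fromℕ-C : ∀ {n k} → k ℕ.≤ n → fromℕ (n C k) * (fromℕ (k !) * fromℕ ((n ∸ k) !)) ≈ fromℕ (n !)
  fromℕ-C {n} {k} k≤n = begin
    fromℕ (n C k) * (fromℕ (k !) * fromℕ ((n ∸ k) !)) ≈⟨ *-congˡ (fromℕ-* (k !) ((n ∸ k) !)) ⟨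
    fromℕ (n C k) * fromℕ (k ! ℕ.* (n ∸ k) !)         ≈⟨ fromℕ-* (n C k) _ ⟨
    fromℕ ((n C k) ℕ.* (k ! ℕ.* (n ∸ k) !))           ≡⟨ ≡.cong fromℕ (nCk*[k!*[n∸k]!] k≤n) ⟩
    fromℕ (n !)                                       ∎

  -- This is where the denominators n + 1 - m come from: they are the coefficients of (e^t - 1)/t
  -- after removal of a factorial.
  n!*E : ∀ n → fromℕ (n !) * E n ≈ 1# / suc n
  n!*E n = fromℕ-cancelˡ (suc n) (begin
    fromℕ (suc n) * (fromℕ (n !) * E n) ≈⟨ *-assoc _ _ _ ⟨
    fromℕ (suc n) * fromℕ (n !) * E n   ≈⟨ *-congʳ (fromℕ-! n) ⟨
    fromℕ (suc n !) * E n               ≈⟨ n!*[x/!n] 1# (suc n) ⟩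
    1#                                  ≈⟨ n*[x/n] 1# (suc n) ⟨
    fromℕ (suc n) * (1# / suc n)        ∎)

  -- The factorials i!, (m - i)! and (n - m)! cancel both binomial coefficients and leave n!, so
  -- each summand becomes a term of a Cauchy product.
  summand : ∀ {n m i} (s b : Carrier) → i ℕ.≤ m → m ℕ.≤ n →
    fromℕ (i !) * (s * fromℕ (n C m) * fromℕ (m C i) * (fromℕ ((m ∸ i) !) * b / suc (n ∸ m))) ≈
    fromℕ (n !) * (b * (s * E (n ∸ m)))
  summand {n} {m} {i} s b i≤m m≤n = begin
    i! * (s * nCm * mCi * (m-i! * b * j⁻¹))
      ≈⟨ solve 7 (λ i s n m k b j → i :* (s :* n :* m :* (k :* b :* j)) := n :* (m :* (i :* k)) :* s :* b :* (:1 :* j)) refl i! s nCm mCi m-i! b j⁻¹ ⟩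
    nCm * (mCi * (i! * m-i!)) * s * b * (1# / suc (n ∸ m))
      ≈⟨ *-cong (*-congʳ (*-congʳ (*-congˡ (fromℕ-C i≤m)))) (sym (n!*E (n ∸ m))) ⟩
    nCm * m! * s * b * (n-m! * E (n ∸ m))
      ≈⟨ solve 6 (λ n m s b k e → n :* m :* s :* b :* (k :* e) := n :* (m :* k) :* (b :* (s :* e))) refl nCm m! s b n-m! (E (n ∸ m)) ⟩
    nCm * (m! * n-m!) * (b * (s * E (n ∸ m)))
      ≈⟨ *-congʳ (fromℕ-C m≤n) ⟩
    fromℕ (n !) * (b * (s * E (n ∸ m))) ∎
    where
    i! = fromℕ (i !)
    m! = fromℕ (m !)
    m-i! = fromℕ ((m ∸ i) !)
    n-m! = fromℕ ((n ∸ m) !)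
    nCm = fromℕ (n C m)
    mCi = fromℕ (m C i)
    j⁻¹ = inverse (fromℕ (suc (n ∸ m))) (fromℕ#0 (suc (n ∸ m)))

  sumFromTo-empty : ∀ {i n} f → n ℕ.< i → sumFromTo i n f ≡ 0#
  sumFromTo-empty {i} {n} f n<i = ≡.cong (λ l → sum {l} (λ k → f (i ℕ.+ toℕ k))) (ℕₚ.m≤n⇒m∸n≡0 n<i)

  sumFromTo-shift : ∀ {i n} f → i ℕ.≤ n → sumFromTo i n f ≡ sumFromTo 0 (n ∸ i) (λ k → f (i ℕ.+ k))
  sumFromTo-shift {i} {n} f i≤n = ≡.cong (λ l → sum {l} (λ k → f (i ℕ.+ toℕ k))) (ℕₚ.+-∸-assoc 1 i≤n)

  sumFromTo-cong : ∀ i n {f g} → (∀ m → f m ≈ g m) → sumFromTo i n f ≈ sumFromTo i n g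
  sumFromTo-cong i n f≈g = sum-cong-≋ {suc n ∸ i} λ k → f≈g (i ℕ.+ toℕ k)

  -- The weight `s` is constantly 1 for the first kind and (-1)^j for the second; both formulas are
  -- thereby treated at once.
  weightedTerm : ℕ → ℕ → Series → Series → ℕ → Carrier
  weightedTerm n i s b m =
    s (n ∸ m) * fromℕ (n C m) * fromℕ (m C i) * (fromℕ ((m ∸ i) !) * b (m ∸ i) / suc (n ∸ m))

  -- Substituting m = i + k turns the sum into the Cauchy product coefficient at n - i, that is, at
  -- n after multiplication by t^i. For n < i both sides are 0.
  sum≈shift : ∀ n i (s b : Series) →
    fromℕ (i !) * sumFromTo i n (weightedTerm n i s b) ≈ fromℕ (n !) * shift i (b ✶ λ j → s j * E j) n
  sum≈shift n i s b with ℕₚ.≤-<-connex i n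
  ... | inj₂ n<i = begin
    fromℕ (i !) * sumFromTo i n (weightedTerm n i s b) ≡⟨ ≡.cong (fromℕ (i !) *_) (sumFromTo-empty (weightedTerm n i s b) n<i) ⟩
    fromℕ (i !) * 0#              ≈⟨ zeroʳ _ ⟩
    0#                            ≈⟨ zeroʳ _ ⟨
    fromℕ (n !) * 0#              ≈⟨ *-congˡ (shift-< (b ✶ λ j → s j * E j) n<i) ⟨
    fromℕ (n !) * shift i (b ✶ λ j → s j * E j) n ∎
  ... | inj₁ i≤n = begin
    fromℕ (i !) * sumFromTo i n term
      ≡⟨ ≡.cong (fromℕ (i !) *_) (sumFromTo-shift term i≤n) ⟩
    fromℕ (i !) * sum {suc (n ∸ i)} (λ k → term (i ℕ.+ toℕ k))
      ≈⟨ *-distribˡ-sum {suc (n ∸ i)} (fromℕ (i !)) (λ k → term (i ℕ.+ toℕ k)) ⟩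
    sum {suc (n ∸ i)} (λ k → fromℕ (i !) * term (i ℕ.+ toℕ k))
      ≈⟨ sum-cong-≋ {suc (n ∸ i)} (λ k → term≈ (toℕ k) (toℕ≤pred[n] k)) ⟩
    sum {suc (n ∸ i)} (λ k → fromℕ (n !) * (b (toℕ k) * weighted (n ∸ i ∸ toℕ k)))
      ≈⟨ *-distribˡ-sum {suc (n ∸ i)} (fromℕ (n !)) (λ k → b (toℕ k) * weighted (n ∸ i ∸ toℕ k)) ⟨
    fromℕ (n !) * (b ⊛ weighted) (n ∸ i)
      ≈⟨ *-congˡ (trans (sym (✶≋⊛ b weighted (n ∸ i))) (sym (shift-≤ (b ✶ weighted) i≤n))) ⟩
    fromℕ (n !) * shift i (b ✶ weighted) n ∎
    where
    weighted : Series
    weighted j = s j * E j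

    term : ℕ → Carrier
    term = weightedTerm n i s b

    term≈ : ∀ k → k ℕ.≤ n ∸ i → fromℕ (i !) * term (i ℕ.+ k) ≈ fromℕ (n !) * (b k * weighted (n ∸ i ∸ k))
    term≈ k k≤n-i = begin
      fromℕ (i !) * term (i ℕ.+ k)
        ≈⟨ summand (s (n ∸ (i ℕ.+ k))) (b (i ℕ.+ k ∸ i)) (ℕₚ.m≤m+n i k) i+k≤n ⟩
      fromℕ (n !) * (b (i ℕ.+ k ∸ i) * weighted (n ∸ (i ℕ.+ k)))
        ≡⟨ ≡.cong₂ (λ u v → fromℕ (n !) * (b u * weighted v)) (ℕₚ.m+n∸m≡n i k) (≡.sym (ℕₚ.∸-+-assoc n i k)) ⟩
      fromℕ (n !) * (b k * weighted (n ∸ i ∸ k)) ∎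
      where
      i+k≤n : i ℕ.+ k ℕ.≤ n
      i+k≤n = ≡.subst (i ℕ.+ k ℕ.≤_) (ℕₚ.m+[n∸m]≡n i≤n) (ℕₚ.+-monoʳ-≤ i k≤n-i)

  -- Uses the transparent product, unlike `B`, so that `bernoulli` unfolds to `n !` times its
  -- coefficients.
  bernoulliˢ : ℕ → Carrier → Series
  bernoulliˢ α x = r ^ˢ α ⊛ expˢ x

  formula₁ : ∀ n i x →
    (- 1#) ^ i * fromℕ (i !) * (∑[ m from i to n ]
      (fromℕ (n C m) * fromℕ (m C i) * (bernoulli (suc n) (m ∸ i) (1# - x) / suc (n ∸ m)))) ≈
    derivative n 1# (- 1#) i x
  formula₁ n i x = begin
    (- 1#) ^ i * fromℕ (i !) * sumFromTo i n term
      ≈⟨ *-assoc _ _ _ ⟩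
    (- 1#) ^ i * (fromℕ (i !) * sumFromTo i n term)
      ≈⟨ *-congˡ (*-congˡ (sumFromTo-cong i n {term} {weightedTerm n i (λ _ → 1#) b} λ m → *-congʳ (*-congʳ (sym (*-identityˡ (fromℕ (n C m))))))) ⟩
    (- 1#) ^ i * (fromℕ (i !) * sumFromTo i n (weightedTerm n i (λ _ → 1#) b))
      ≈⟨ *-congˡ (sum≈shift n i (λ _ → 1#) b) ⟩
    (- 1#) ^ i * (fromℕ (n !) * shift i (b ✶ λ j → 1# * E j) n)
      ≈⟨ *-congˡ (*-congˡ (shift-cong i series n)) ⟩
    (- 1#) ^ i * (fromℕ (n !) * shift i (B n (1# + - 1# * x)) n)
      ≈⟨ solve 3 (λ a b c → a :* (b :* c) := b :* a :* c) refl ((- 1#) ^ i) (fromℕ (n !)) _ ⟩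
    derivative n 1# (- 1#) i x ∎
    where
    b : Series
    b = bernoulliˢ (suc n) (1# - x)

    term : ℕ → Carrier
    term m = fromℕ (n C m) * fromℕ (m C i) * (bernoulli (suc n) (m ∸ i) (1# - x) / suc (n ∸ m))

    series : b ✶ (λ j → 1# * E j) ≋ B n (1# + - 1# * x)
    series = S.trans
      (✶-cong (S.sym (✶≋⊛ (r ^ˢ suc n) (expˢ (1# - x)))) (λ j → *-identityˡ (E j)))
      (S.trans (B-suc-✶E n (1# - x)) (B-cong n (solve 1 (λ x → :1 :- x := :1 :+ :- :1 :* x) refl x)))

  -- The signs turn E into `E⁻`, and e^t E⁻ = E absorbs the shift of the argument from x to x + 1.
  formula₂ : ∀ n i x →
    fromℕ (i !) * (∑[ m from i to n ]
      ((- 1#) ^ (n ∸ m) * fromℕ (n C m) * fromℕ (m C i) * (bernoulli (suc n) (m ∸ i) (x + 1#) / suc (n ∸ m)))) ≈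
    derivative n 0# 1# i x
  formula₂ n i x = begin
    fromℕ (i !) * sumFromTo i n (weightedTerm n i (λ j → (- 1#) ^ j) b)
      ≈⟨ sum≈shift n i (λ j → (- 1#) ^ j) b ⟩
    fromℕ (n !) * shift i (b ✶ E⁻) n
      ≈⟨ *-congˡ (shift-cong i series n) ⟩
    fromℕ (n !) * shift i (B n (0# + 1# * x)) n
      ≈⟨ *-congʳ (trans (*-congˡ (1^n≈1 i)) (*-identityʳ _)) ⟨
    derivative n 0# 1# i x ∎
    where
    b : Series
    b = bernoulliˢ (suc n) (x + 1#)

    series : b ✶ E⁻ ≋ B n (0# + 1# * x)
    series = S.trans
      (✶-cong (S.sym (✶≋⊛ (r ^ˢ suc n) (expˢ (x + 1#)))) S.refl)
      (S.trans (B-suc-✶E⁻ n x) (B-cong n (solve 1 (λ x → x := :0 :+ :1 :* x) refl x)))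

  cauchy₁ : ∀ {p} → IsCauchyPolynomial₁ p → ∀ n x → p n x ≈ derivative n 1# (- 1#) 0 x
  cauchy₁ {p} isCauchy n x = let I , integral , p≈ = isCauchy n x in begin
    p n x
      ≈⟨ p≈ ⟩
    fromℕ (n !) * I
      ≈⟨ *-cong (sym (*-identityʳ _)) (trans (integral₁ integral) (B-cong n (solve 1 (λ x → :1 :- x := :1 :+ :- :1 :* x) refl x) n)) ⟩
    fromℕ (n !) * 1# * B n (1# + - 1# * x) n ∎

  cauchy₂ : ∀ {p} → IsCauchyPolynomial₂ p → ∀ n x → p n x ≈ derivative n 0# 1# 0 x
  cauchy₂ {p} isCauchy n x = let I , integral , p≈ = isCauchy n x in begin
    p n x
      ≈⟨ p≈ ⟩
    fromℕ (n !) * I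
      ≈⟨ *-cong (sym (*-identityʳ _)) (trans (integral₂ integral) (B-cong n (solve 1 (λ x → x := :0 :+ :1 :* x) refl x) n)) ⟩
    fromℕ (n !) * 1# * B n (0# + 1# * x) n ∎

theorem5 : ∀ {c ℓ₁ ℓ₂ ℓ₃} (R : RealNumbers c ℓ₁ ℓ₂ ℓ₃) →
    let open RealNumbers R hiding (zero)
        open Analysis R
    in (∀ (p : ℕ → Carrier → Carrier) → IsCauchyPolynomial₁ p → ∀ n i →
          IsIteratedDerivative i (p n) (λ x →
            (- 1#) ^ i * fromℕ (i !) * (∑[ m from i to n ]
              (fromℕ (n C m) * fromℕ (m C i) * (bernoulli (suc n) (m ∸ i) (1# - x) / suc (n ∸ m))))))
       × (∀ (p : ℕ → Carrier → Carrier) → IsCauchyPolynomial₂ p → ∀ n i →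
          IsIteratedDerivative i (p n) (λ x →
            fromℕ (i !) * (∑[ m from i to n ]
              ((- 1#) ^ (n ∸ m) * fromℕ (n C m) * fromℕ (m C i) * (bernoulli (suc n) (m ∸ i) (x + 1#) / suc (n ∸ m))))))
theorem5 R =
  (λ p isCauchy n i → IsIteratedDerivative-resp (λ x → sym (formula₁ n i x))
    (iterate (derivative n 1# (- 1#)) (cauchy₁ isCauchy n) (derivative-suc n 1# (- 1#)) i)) ,
  (λ p isCauchy n i → IsIteratedDerivative-resp (λ x → sym (formula₂ n i x))
    (iterate (derivative n 0# 1#) (cauchy₂ isCauchy n) (derivative-suc n 0# 1#) i))
  where
  open RealNumbers R using (1#; 0#; -_; sym)
  open CauchyPolynomials R
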